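{- Let $x_1,x_2,y_1,y_2,u_1,u_2,v_2,\lambda$ and $\mathbf{w}=(w_\ell)_{\ell\ge 0}$ be commuting indeterminates. For $n\ge 0$ let \[ \widehat{Q}_n(x_1,x_2,y_1,y_2,u_1,u_2,v_1,v_2,\mathbf{w},\lambda)=\sum_{\sigma\in\mathfrak{S}_n} x_1^{\mathrm{eareccpeak}(\sigma)}x_2^{\mathrm{eareccdfall}(\sigma)}y_1^{\mathrm{ereccval}(\sigma)}y_2^{\mathrm{ereccdrise}(\sigma)}u_1^{\mathrm{nrcpeak}(\sigma)}u_2^{\mathrm{nrcdfall}(\sigma)}v_1^{\mathrm{nrcval}(\sigma)}v_2^{\mathrm{nrcdrise}(\sigma)}\Big(\prod_{i\in\mathrm{Fix}(\sigma)}w_{\mathrm{psnest}(i,\sigma)}\Big)\lambda^{\mathrm{cyc}(\sigma)} . \] Then, as formal power series in $t$, \[ \sum_{n\ge0}\widehat{Q}_n(x_1,x_2,y_1,y_2,u_1,u_2,y_1,v_2,\mathbf{w},\lambda)\,t^n =\cfrac{1}{1-\gamma_0t-\cfrac{\beta_1t^2}{1-\gamma_1t-\cfrac{\beta_2t^2}{1-\gamma_2 t-\cdots}}} \] (i.e. with $v_1$ specialised to $y_1$), where $\gamma_0=\lambda w_0$, $\gamma_n=[x_2+(n-1)u_2]+[y_2+(n-1)v_2]+\lambda w_n$ for $n\ge1$, and $\beta_n=(\lambda+n-1)[x_1+(n-1)u_1]\,y_1$ for $n\ge1$.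
   Context: $\mathfrak{S}_n$ is the set of permutations of $[n]=\{1,\dots,n\}$. For $\sigma\in\mathfrak{S}_n$, an index $i$ is a cycle peak if $\sigma^{ -1}(i)<i>\sigma(i)$, a cycle valley if $\sigma^{ -1}(i)>i<\sigma(i)$, a cycle double rise if $\sigma^{ -1}(i)<i<\sigma(i)$, a cycle double fall if $\sigma^{ -1}(i)>i>\sigma(i)$, a fixed point if $\sigma(i)=i$; $\mathrm{Fix}(\sigma)$ is the set of fixed points. An index $i$ is a record if $\sigma(j)<\sigma(i)$ for all $j<i$, and an antirecord if $\sigma(j)>\sigma(i)$ for all $j>i$; it is an exclusive record if it is a record but not an antirecord, an exclusive antirecord if it is an antirecord but not a record, and "nr" if it is neither a record nor an antirecord. Then $\mathrm{eareccpeak}(\sigma)$ (resp. $\mathrm{eareccdfall}(\sigma)$) is the number of cycle peaks (resp. cycle double falls) that are exclusive antirecords; $\mathrm{ereccval}(\sigma)$ (resp. $\mathrm{ereccdrise}(\sigma)$) is the number of cycle valleys (resp. cycle double rises) that are exclusive records; $\mathrm{nrcpeak},\mathrm{nrcdfall},\mathrm{nrcval},\mathrm{nrcdrise}$ count cycle peaks, cycle double falls, cycle valleys, cycle double rises that are neither records nor antirecords. For a fixed point $i$, $\mathrm{psnest}(i,\sigma)=\#\{j<i:\sigma(j)>i\}$. $\mathrm{cyc}(\sigma)$ is the number of cycles of $\sigma$ (fixed points count as cycles). -}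

module Defs where

open import Level using (Level)
open import Data.Nat as ℕ using (ℕ; zero; suc; _<_; _≤_)
open import Data.Nat.Properties using (_<?_; _≟_)
open import Data.Fin as F using (Fin; toℕ)
open import Data.Fin.Properties as FP using ()
open import Data.Vec as V using (Vec; []; _∷_; lookup)
open import Data.List as L using (List; []; _∷_; allFin; filter; length; upTo; zipWith; _++_; concatMap)
open import Data.List.Relation.Unary.All using (all?)
open import Data.Bool using (Bool; true; false)
open import Data.Product using (_×_; _,_)
open import Data.Maybe using (Maybe; just; nothing)
open import Relation.Nullary using (Dec; yes; no; ¬_; _×-dec_; ¬?)
open import Relation.Nullary.Decidable using (⌊_⌋)
open import Relation.Unary using (Decidable)
open import Relation.Binary.PropositionalEquality using (_≡_)
open import Algebra.Bundles using (CommutativeRing)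
import Algebra.Bundles

-- Permutations of [n] = Fin n, represented as vectors of images.
-- 𝔖ₙ is the list of all injective maps Fin n → Fin n (= bijections).

allVecs : (m k : ℕ) → List (Vec (Fin k) m)
allVecs zero    k = V.[] ∷ []
allVecs (suc m) k = concatMap (λ i → L.map (i V.∷_) (allVecs m k)) (allFin k)

Injective? : ∀ {n} (σ : Vec (Fin n) n) → Dec (∀ i j → lookup σ i ≡ lookup σ j → i ≡ j)
Injective? {n} σ = FP.all? λ i → FP.all? λ j → decImp (lookup σ i F.≟ lookup σ j) (i F.≟ j)
  where
  decImp : ∀ {a b} {A : Set a} {B : Set b} → Dec A → Dec B → Dec (A → B)
  decImp (yes a) (yes b) = yes (λ _ → b)
  decImp (yes a) (no ¬b) = no (λ f → ¬b (f a))
  decImp (no ¬a) _       = yes (λ a → Data.Empty.⊥-elim (¬a a))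
    where import Data.Empty

Sym : (n : ℕ) → List (Vec (Fin n) n)
Sym n = filter Injective? (allVecs n n)

module _ {n : ℕ} (σ : Vec (Fin n) n) where

  app : Fin n → Fin n
  app = lookup σ

  inv : Fin n → Fin n
  inv i = go (allFin n)
    where
    go : List (Fin n) → Fin n
    go []       = i
    go (j ∷ js) with lookup σ j F.≟ i
    ... | yes _ = j
    ... | no  _ = go js

  _<F_ : Fin n → Fin n → Set
  a <F b = toℕ a < toℕ b

  _<F?_ : (a b : Fin n) → Dec (a <F b)
  a <F? b = toℕ a <? toℕ b

  CPeak CValley CDRise CDFall Fixed : Fin n → Set
  CPeak   i = (inv i <F i) × (app i <F i)
  CValley i = (i <F inv i) × (i <F app i)
  CDRise  i = (inv i <F i) × (i <F app i)
  CDFall  i = (i <F inv i) × (app i <F i)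
  Fixed   i = app i ≡ i

  cpeak? : Decidable CPeak
  cpeak? i = (inv i <F? i) ×-dec (app i <F? i)
  cvalley? : Decidable CValley
  cvalley? i = (i <F? inv i) ×-dec (i <F? app i)
  cdrise? : Decidable CDRise
  cdrise? i = (inv i <F? i) ×-dec (i <F? app i)
  cdfall? : Decidable CDFall
  cdfall? i = (i <F? inv i) ×-dec (app i <F? i)
  fixed? : Decidable Fixed
  fixed? i = app i F.≟ i

  Record AntiRecord : Fin n → Set
  Record     i = ∀ j → j <F i → app j <F app i
  AntiRecord i = ∀ j → i <F j → app i <F app j

  record? : Decidable Record
  record? i = FP.all? λ j → imp (j <F? i) (app j <F? app i)
    where
    imp : ∀ {A B : Set} → Dec A → Dec B → Dec (A → B)
    imp (yes a) (yes b) = yes (λ _ → b)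
    imp (yes a) (no ¬b) = no (λ f → ¬b (f a))
    imp (no ¬a) _       = yes (λ a → Data.Empty.⊥-elim (¬a a))
      where import Data.Empty

  antirecord? : Decidable AntiRecord
  antirecord? i = FP.all? λ j → imp (i <F? j) (app i <F? app j)
    where
    imp : ∀ {A B : Set} → Dec A → Dec B → Dec (A → B)
    imp (yes a) (yes b) = yes (λ _ → b)
    imp (yes a) (no ¬b) = no (λ f → ¬b (f a))
    imp (no ¬a) _       = yes (λ a → Data.Empty.⊥-elim (¬a a))
      where import Data.Empty

  ERec EARec NR : Fin n → Set
  ERec  i = Record i × ¬ AntiRecord i
  EARec i = AntiRecord i × ¬ Record i
  NR    i = ¬ Record i × ¬ AntiRecord i

  erec? : Decidable ERec
  erec? i = record? i ×-dec ¬? (antirecord? i)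
  earec? : Decidable EARec
  earec? i = antirecord? i ×-dec ¬? (record? i)
  nr? : Decidable NR
  nr? i = ¬? (record? i) ×-dec ¬? (antirecord? i)

  countFin : {P : Fin n → Set} → Decidable P → ℕ
  countFin P? = length (filter P? (allFin n))

  eareccpeak eareccdfall ereccval ereccdrise : ℕ
  eareccpeak  = countFin (λ i → earec? i ×-dec cpeak? i)
  eareccdfall = countFin (λ i → earec? i ×-dec cdfall? i)
  ereccval    = countFin (λ i → erec? i ×-dec cvalley? i)
  ereccdrise  = countFin (λ i → erec? i ×-dec cdrise? i)

  nrcpeak nrcdfall nrcval nrcdrise : ℕ
  nrcpeak  = countFin (λ i → nr? i ×-dec cpeak? i)
  nrcdfall = countFin (λ i → nr? i ×-dec cdfall? i)
  nrcval   = countFin (λ i → nr? i ×-dec cvalley? i)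
  nrcdrise = countFin (λ i → nr? i ×-dec cdrise? i)

  psnest : Fin n → ℕ
  psnest i = countFin (λ j → (j <F? i) ×-dec (i <F? app j))

  fixList : List (Fin n)
  fixList = filter fixed? (allFin n)

  iter : ℕ → Fin n → Fin n
  iter zero    i = i
  iter (suc k) i = app (iter k i)

  -- i is the smallest element of its cycle (the cycle of i is
  -- {σᵏ(i) : 0 ≤ k < n}); cyc(σ) = number of cycles = number of cycle minima
  CycMin : Fin n → Set
  CycMin i = ∀ (k : Fin n) → ¬ (iter (toℕ k) i <F i)

  cycMin? : Decidable CycMin
  cycMin? i = FP.all? λ k → ¬? (iter (toℕ k) i <F? i)

  cyc : ℕ
  cyc = countFin cycMin?

-- Everything in an arbitrary commutative ring R (the indeterminates are
-- arbitrary elements; an identity for all commutative rings and all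
-- values is the same as an identity of polynomials over ℤ).

module Ring {c ℓ : Level} (R : CommutativeRing c ℓ) where
  open CommutativeRing R public
  open import Algebra.Definitions.RawSemiring (Algebra.Bundles.Semiring.rawSemiring semiring) using (_^_) public

  Σᴸ : List Carrier → Carrier
  Σᴸ = L.foldr _+_ 0#

  Πᴸ : List Carrier → Carrier
  Πᴸ = L.foldr _*_ 1#

  Qhat : ℕ → (x₁ x₂ y₁ y₂ u₁ u₂ v₁ v₂ : Carrier) → (w : ℕ → Carrier) → (lam : Carrier) → Carrier
  Qhat n x₁ x₂ y₁ y₂ u₁ u₂ v₁ v₂ w lam = Σᴸ (L.map weight (Sym n))
    where
    weight : Vec (Fin n) n → Carrier
    weight σ = x₁ ^ eareccpeak σ * x₂ ^ eareccdfall σ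
             * y₁ ^ ereccval σ * y₂ ^ ereccdrise σ
             * u₁ ^ nrcpeak σ * u₂ ^ nrcdfall σ
             * v₁ ^ nrcval σ * v₂ ^ nrcdrise σ
             * Πᴸ (L.map (λ i → w (psnest σ i)) (fixList σ))
             * lam ^ cyc σ

  Series : Set c
  Series = ℕ → Carrier

  one : Series
  one zero    = 1#
  one (suc _) = 0#

  -- coefficients h₀,…,hₘ (listed as hₘ ∷ … ∷ h₀) of h = 1/(1 - t·g),
  -- i.e. the unique series with h = 1 + t·g·h
  geomRev : Series → ℕ → List Carrier
  geomRev g zero    = 1# ∷ []
  geomRev g (suc m) = Σᴸ (zipWith _*_ (L.map g (upTo (suc m))) (geomRev g m)) ∷ geomRev g m

  geom : Series → Series
  geom g m with geomRev g m
  ... | h ∷ _ = h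
  ... | []    = 0#

  -- k-th convergent of the J-fraction starting at level h:
  --   J⁽ʰ⁾₀ = 1,
  --   J⁽ʰ⁾ₖ₊₁ = 1 / (1 - γₕ t - βₕ₊₁ t² J⁽ʰ⁺¹⁾ₖ) = 1/(1 - t (γₕ + βₕ₊₁ t J⁽ʰ⁺¹⁾ₖ))
  conv : (γ β : ℕ → Carrier) → ℕ → ℕ → Series
  conv γ β zero    h = one
  conv γ β (suc k) h = geom g
    where
    g : Series
    g zero    = γ h
    g (suc m) = β (suc h) * conv γ β k (suc h) m

  open import Algebra.Definitions.RawSemiring (Algebra.Bundles.Semiring.rawSemiring semiring) using () renaming (_×_ to _·_) public

  γseq : (x₂ y₂ u₂ v₂ : Carrier) (w : ℕ → Carrier) (lam : Carrier) → ℕ → Carrier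
  γseq x₂ y₂ u₂ v₂ w lam zero    = lam * w 0
  γseq x₂ y₂ u₂ v₂ w lam (suc m) = (x₂ + (m · u₂)) + (y₂ + (m · v₂)) + lam * w (suc m)

  βseq : (x₁ y₁ u₁ lam : Carrier) → ℕ → Carrier
  βseq x₁ y₁ u₁ lam zero    = 0#   -- unused (β₀ does not occur)
  βseq x₁ y₁ u₁ lam (suc m) = (lam + (m · 1#)) * (x₁ + (m · u₁)) * y₁

{-# OPTIONS --safe #-}
module Submission where

-- Scan the indices of σ from left to right. After h paths have been opened, a
-- partial scan is encoded as a permutation whose first h entries are all ≥ h
-- (one such entry for each open path), weighted by the statistics of the indices
-- ≥ h and by lam ^ cyc. Let T n h be the weighted sum over such permutations of
-- [n], so that T n 0 is Qhat n. Classify them by the type of the element H = h.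
-- A valley H opens one more path. A fixed point or a double rise H is deleted
-- from its cycle: h possible predecessors of H remain, exactly one of which makes
-- H a record. If σ(H) = r < H, then r is deleted from its cycle: H is an
-- antirecord exactly when r = 0, independently of the smaller permutation, in
-- which H has become a valley (double fall), a rise (peak joining two paths) or
-- a fixed point (peak closing a cycle, whence the factor lam + (h - 1)). The
-- statistics of the indices above H are unaffected. The resulting three-term
-- recurrence for T is that of weighted Motzkin paths, whose generating function
-- is the J-fraction; v₁ = y₁ is what makes the weight of a valley independent of
-- its being a record.

open import Defs
open import Level using (Level)
open import Data.Nat as ℕ using (ℕ; zero; suc; _≤_; _<_; z≤n; s≤s; z<s; s<s; _∸_)
import Data.Nat.Properties as ℕₚ
open import Data.Nat.DivMod using (_%_; _/_; m≡m%n+[m/n]*n; m%n<n)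
open import Data.Nat.Induction using (<-rec)
open import Data.Bool using (Bool; true; false; if_then_else_)
open import Data.Fin as F using (Fin; zero; suc; toℕ; punchIn; punchOut)
import Data.Fin.Properties as Fₚ
open import Data.Fin.Permutation.Components using (transpose; transpose-inverse)
open import Data.Vec as V using (Vec; lookup; tabulate)
import Data.Vec.Properties as Vₚ
open import Data.List as L
  using (List; []; _∷_; length; filter; allFin; applyUpTo; zipWith; _++_; map; concatMap; cartesianProductWith)
import Data.List.Properties as Lₚ
open import Data.List.Membership.Propositional using (_∈_)
import Data.List.Membership.Propositional.Properties as ∈ₚ
open import Data.List.Relation.Unary.Any using (here; there)
open import Data.List.Relation.Unary.All as All using (All; []; _∷_)
import Data.List.Relation.Unary.All.Properties as Allₚ
open import Data.List.Relation.Unary.AllPairs using ([]; _∷_)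
open import Data.List.Relation.Unary.Unique.Propositional using (Unique)
import Data.List.Relation.Unary.Unique.Propositional.Properties as Uₚ
open import Data.List.Relation.Binary.Pointwise as PW using (Pointwise; []; _∷_)
open import Data.List.Relation.Binary.Permutation.Propositional as Perm↭
  using (_↭_; ↭-refl; ↭-sym; ↭-trans; ↭⇒↭ₛ)
import Data.List.Relation.Binary.Permutation.Propositional.Properties as ↭ₚ
import Data.List.Relation.Binary.Permutation.Setoid.Properties as ↭ₛ
open import Data.Product using (∃; _×_; _,_; proj₁; proj₂)
open import Data.Sum using (_⊎_; inj₁; inj₂)
open import Data.Maybe using (Maybe; just; nothing)
import Data.Maybe.Properties as Maybeₚ
open import Data.Empty using (⊥; ⊥-elim)
open import Function using (_∘_; id; case_of_)
open import Relation.Nullary using (Dec; yes; no; ¬_; ¬?; _×-dec_; _→-dec_)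
open import Relation.Nullary.Decidable using (dec-true; dec-false)
open import Relation.Nullary.Reflects using (Reflects; ofʸ; ofⁿ)
open import Relation.Unary using (Decidable)
open import Relation.Binary.Definitions using (tri<; tri≈; tri>)
open import Relation.Binary.PropositionalEquality as ≡ using (_≡_; _≢_)
open import Algebra.Bundles using (CommutativeRing)
import Algebra.Properties.CommutativeMonoid.Sum as CMSum
import Algebra.Solver.Ring.NaturalCoefficients.Default as Solver
import Relation.Binary.Reasoning.Setoid as SetoidReasoning

-- Records, antirecords and `psnest` compare an index with all others, whereas a scan has to forget
-- what it has passed. The placeholders r < h reconcile the two: r keeps only the exit σ(r) of its
-- path and the entry σ⁻¹(r). The record status of a rise is decided after H has been deleted, by
-- averaging over the possible predecessors in a fixed smaller permutation. A valley deletes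
-- nothing: H stays in the state as a new placeholder, so no such average is available, and its
-- weight must not depend on its record status. In a fall, H is attached in front of the path of r.
-- Deleting r instead of H keeps the remaining placeholders an initial segment and leaves an index
-- that no longer falls, so that the analysis of the non-falling indices applies a second time.
-- Deletion is a relation, `Del`, and sums are transported along relations that are functional,
-- injective, total and onto; this spares mutually inverse functions on vectors.

module Combinatorics where
  open import Data.Nat using (_+_; _*_)
  open ≡ using (refl; sym; trans; cong; subst; subst₂)

  -- Duplicate-free lists matched by a relation.

  matching : ∀ {A B : Set} (R : A → B → Set)
    → (∀ {x y y'} → R x y → R x y' → y ≡ y')
    → (∀ {x x' y} → R x y → R x' y → x ≡ x')
    → ∀ {xs ys} → Unique xs → Unique ys
    → (∀ {x} → x ∈ xs → ∃ λ y → y ∈ ys × R x y)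
    → (∀ {y} → y ∈ ys → ∃ λ x → x ∈ xs × R x y)
    → ∃ λ zs → zs ↭ ys × Pointwise R xs zs
  matching R fun inj {[]} {[]} _ _ _ _ = [] , ↭-refl , []
  matching R fun inj {[]} {y ∷ ys} _ _ _ onto with onto (here refl)
  ... | _ , () , _
  matching R fun inj {x ∷ xs} {ys} (x∉xs ∷ uxs) uys total onto with total (here refl)
  ... | y , y∈ys , Rxy with ∈ₚ.∈-∃++ y∈ys
  ...   | ps , qs , refl = extend (↭ₛ.Unique-resp-↭ (≡.setoid _) (↭⇒↭ₛ (↭ₚ.shift y ps qs)) uys)
    where
    toRest : ∀ {z} → z ∈ ps ++ L.[ y ] ++ qs → z ≢ y → z ∈ ps ++ qs
    toRest z∈ z≢y with ↭ₚ.∈-resp-↭ (↭ₚ.shift y ps qs) z∈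
    ... | here z≡y = ⊥-elim (z≢y z≡y)
    ... | there z∈′ = z∈′

    extend : Unique (y ∷ ps ++ qs) → ∃ λ zs → zs ↭ ps ++ L.[ y ] ++ qs × Pointwise R (x ∷ xs) zs
    -- The pair x, y can be removed from both sides: `inj` keeps y from the other entries of `xs`,
    -- and `fun` keeps x from the other entries of `ys`.
    extend (y∉ ∷ urest) with matching R fun inj uxs urest total′ onto′
      where
      total′ : ∀ {x'} → x' ∈ xs → ∃ λ y' → y' ∈ ps ++ qs × R x' y'
      total′ x'∈ with total (there x'∈)
      ... | y' , y'∈ , Rx'y' = y' , toRest y'∈ (λ { refl → All.lookup x∉xs x'∈ (inj Rxy Rx'y') }) , Rx'y'
      onto′ : ∀ {y'} → y' ∈ ps ++ qs → ∃ λ x' → x' ∈ xs × R x' y'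
      onto′ y'∈ with onto (↭ₚ.∈-resp-↭ (↭-sym (↭ₚ.shift y ps qs)) (there y'∈))
      ... | x' , there x'∈ , r = x' , x'∈ , r
      ... | x' , here refl , r = ⊥-elim (All.lookup y∉ y'∈ (fun Rxy r))
    ... | zs , zs↭ , pw = y ∷ zs , ↭-trans (Perm↭.prep y zs↭) (↭-sym (↭ₚ.shift y ps qs)) , Rxy ∷ pw

  matching-length : ∀ {A B : Set} (R : A → B → Set)
    → (∀ {x y y'} → R x y → R x y' → y ≡ y')
    → (∀ {x x' y} → R x y → R x' y → x ≡ x')
    → ∀ {xs ys} → Unique xs → Unique ys
    → (∀ {x} → x ∈ xs → ∃ λ y → y ∈ ys × R x y)
    → (∀ {y} → y ∈ ys → ∃ λ x → x ∈ xs × R x y)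
    → length xs ≡ length ys
  matching-length R fun inj uxs uys total onto with matching R fun inj uxs uys total onto
  ... | zs , zs↭ys , pw = trans (PW.Pointwise-length pw) (↭ₚ.↭-length zs↭ys)

  -- Order and relabelling through `punchIn`.

  module _ {n : ℕ} where
    punchIn-mono-< : ∀ d {j k : Fin n} → j F.< k → punchIn d j F.< punchIn d k
    punchIn-mono-< d {j} {k} j<k = ℕₚ.≰⇒> λ le → ℕₚ.<⇒≱ j<k (Fₚ.punchIn-cancel-≤ d k j le)

    punchIn-cancel-< : ∀ d {j k : Fin n} → punchIn d j F.< punchIn d k → j F.< k
    punchIn-cancel-< d {j} {k} lt = ℕₚ.≰⇒> λ le → ℕₚ.<⇒≱ lt (Fₚ.punchIn-mono-≤ d k j le)

    punchIn-preimage : ∀ {d i : Fin (suc n)} → i ≢ d → ∃ λ j → i ≡ punchIn d j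
    punchIn-preimage i≢d = punchOut (i≢d ∘ sym) , sym (Fₚ.punchIn-punchOut (i≢d ∘ sym))

  toℕ-punchIn : ∀ {n} (d : Fin (suc n)) (j : Fin n)
    → (toℕ j < toℕ d × toℕ (punchIn d j) ≡ toℕ j) ⊎ (toℕ d ≤ toℕ j × toℕ (punchIn d j) ≡ suc (toℕ j))
  toℕ-punchIn zero j = inj₂ (z≤n , refl)
  toℕ-punchIn (suc d) zero = inj₁ (z<s , refl)
  toℕ-punchIn (suc d) (suc j) with toℕ-punchIn d j
  ... | inj₁ (lt , eq) = inj₁ (s<s lt , cong suc eq)
  ... | inj₂ (le , eq) = inj₂ (s≤s le , cong suc eq)

  toℕ-punchIn-≥ : ∀ {n} {d : Fin (suc n)} {j : Fin n} → toℕ d ≤ toℕ j → toℕ (punchIn d j) ≡ suc (toℕ j)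
  toℕ-punchIn-≥ {d = d} {j} le with toℕ-punchIn d j
  ... | inj₁ (lt , _) = ⊥-elim (ℕₚ.<⇒≱ lt le)
  ... | inj₂ (_ , eq) = eq

  toℕ-punchIn-< : ∀ {n} {d : Fin (suc n)} {j : Fin n} → toℕ j < toℕ d → toℕ (punchIn d j) ≡ toℕ j
  toℕ-punchIn-< {d = d} {j} lt with toℕ-punchIn d j
  ... | inj₁ (_ , eq) = eq
  ... | inj₂ (le , _) = ⊥-elim (ℕₚ.<⇒≱ lt le)

  -- Injective self-maps of a finite set.

  Inj : ∀ {n} → (Fin n → Fin n) → Set
  Inj f = ∀ i j → f i ≡ f j → i ≡ j

  Inj⇒surjective : ∀ {n} {f : Fin n → Fin n} → Inj f → ∀ i → ∃ λ j → f j ≡ i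
  Inj⇒surjective {suc n} {f} inj i with Fₚ.any? (λ j → f j F.≟ i)
  ... | yes p = p
  ... | no ∄ = ⊥-elim (clash (Fₚ.pigeonhole (ℕₚ.n<1+n n) (λ j → punchOut (miss j))))
    where
    miss : ∀ j → i ≢ f j
    miss j e = ∄ (j , sym e)
    clash : (∃ λ a → ∃ λ b → a F.< b × punchOut (miss a) ≡ punchOut (miss b)) → ⊥
    clash (a , b , a<b , e) = ℕₚ.<⇒≢ a<b (cong toℕ (inj a b (Fₚ.punchOut-injective (miss a) (miss b) e)))

  -- Pigeonhole: the a + 1 positions up to a take distinct values among b + 1. Applied to σ and to
  -- its inverse, this rules out falling records and exceeding antirecords.
  prefix-bound : ∀ {n} {f : Fin n → Fin n} → Inj f → ∀ (a b : Fin n)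
    → (∀ (j : Fin n) → j F.≤ a → f j F.≤ b) → a F.≤ b
  prefix-bound {n} {f} inj a b bound = ℕₚ.≮⇒≥ λ b<a → clash (Fₚ.pigeonhole (s<s b<a) g)
    where
    below : (k : Fin (suc (toℕ a))) → toℕ k < n
    below k = ℕₚ.<-≤-trans (Fₚ.toℕ<n k) (Fₚ.toℕ<n a)
    pos : Fin (suc (toℕ a)) → Fin n
    pos k = F.fromℕ< (below k)
    pos≤a : ∀ k → pos k F.≤ a
    pos≤a k = subst (_≤ toℕ a) (sym (Fₚ.toℕ-fromℕ< (below k))) (ℕ.s≤s⁻¹ (Fₚ.toℕ<n k))
    g : Fin (suc (toℕ a)) → Fin (suc (toℕ b))
    g k = F.fromℕ< (s≤s (bound (pos k) (pos≤a k)))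
    toℕ-g : ∀ k → toℕ (g k) ≡ toℕ (f (pos k))
    toℕ-g k = Fₚ.toℕ-fromℕ< (s≤s (bound (pos k) (pos≤a k)))
    clash : (∃ λ i → ∃ λ j → i F.< j × g i ≡ g j) → ⊥
    clash (i , j , i<j , e) = ℕₚ.<⇒≢ i<j (trans (sym (Fₚ.toℕ-fromℕ< (below i)))
      (trans (cong toℕ (inj (pos i) (pos j) (Fₚ.toℕ-injective (trans (sym (toℕ-g i)) (trans (cong toℕ e) (toℕ-g j))))))
        (Fₚ.toℕ-fromℕ< (below j))))

  Perm : ∀ {n} → Vec (Fin n) n → Set
  Perm σ = Inj (lookup σ)

  -- Orbits and cycle minima.

  module _ {n} (σ : Vec (Fin n) n) where

    iter-+ : ∀ a b i → iter σ (a + b) i ≡ iter σ a (iter σ b i)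
    iter-+ zero    b i = refl
    iter-+ (suc a) b i = cong (lookup σ) (iter-+ a b i)

    iter-suc : ∀ k i → iter σ (suc k) i ≡ iter σ k (lookup σ i)
    iter-suc k i = trans (cong (λ m → iter σ m i) (ℕₚ.+-comm 1 k)) (iter-+ k 1 i)

    iter-* : ∀ p k i → iter σ p i ≡ i → iter σ (k * p) i ≡ i
    iter-* p zero    i e = refl
    iter-* p (suc k) i e = trans (iter-+ p (k * p) i) (trans (cong (iter σ p) (iter-* p k i e)) e)

    _⇝_ : Fin n → Fin n → Set
    i ⇝ j = ∃ λ k → iter σ k i ≡ j

    ⇝-trans : ∀ {i j k} → i ⇝ j → j ⇝ k → i ⇝ k
    ⇝-trans {i} (a , refl) (b , refl) = b + a , iter-+ b a i

    ⇝-refl : ∀ {i} → i ⇝ i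
    ⇝-refl = 0 , refl

    module _ (inj : Perm σ) where

      iter-injective : ∀ k {i j} → iter σ k i ≡ iter σ k j → i ≡ j
      iter-injective zero    e = e
      iter-injective (suc k) e = iter-injective k (inj _ _ e)

      period : ∀ i → ∃ λ p → p < n × iter σ (suc p) i ≡ i
      period i with Fₚ.pigeonhole (ℕₚ.n<1+n n) (λ k → iter σ (toℕ k) i)
      ... | a , b , a<b , e = q , q<n ,
          iter-injective (toℕ a) (trans (sym (iter-+ (toℕ a) (suc q) i))
            (trans (cong (λ m → iter σ m i) split) (sym e)))
        where
        q = toℕ b ∸ suc (toℕ a)
        split : toℕ a + suc q ≡ toℕ b
        split = trans (ℕₚ.+-suc (toℕ a) q) (ℕₚ.m+[n∸m]≡n a<b)
        q<n : q < n
        q<n = ℕₚ.≤-trans (ℕₚ.≤-trans (ℕₚ.m≤n+m (suc q) (toℕ a)) (ℕₚ.≤-reflexive split))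
                (ℕ.s≤s⁻¹ (Fₚ.toℕ<n b))

      ⇝-sym : ∀ {i j} → i ⇝ j → j ⇝ i
      ⇝-sym {i} (k , refl) with period i
      -- With period p + 1, the k steps made and k * p further ones amount to k full turns.
      ... | p , _ , e = k * p , trans (sym (iter-+ (k * p) k i))
              (trans (cong (λ m → iter σ m i) (trans (ℕₚ.+-comm (k * p) k) (sym (ℕₚ.*-suc k p)))) (iter-* (suc p) k i e))

      -- `CycMin` inspects only exponents below n; reduction modulo the period, which is at most n,
      -- shows that these reach the whole orbit.
      ⇝-short : ∀ {i j} → i ⇝ j → ∃ λ (k : Fin n) → iter σ (toℕ k) i ≡ j
      ⇝-short {i} (k , refl) with period i
      ... | p , p<n , e = F.fromℕ< r<n , trans (cong (λ m → iter σ m i) (Fₚ.toℕ-fromℕ< r<n)) (sym reduce)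
        where
        r = k % suc p
        r<n : r < n
        r<n = ℕₚ.≤-trans (m%n<n k (suc p)) p<n
        reduce : iter σ k i ≡ iter σ r i
        reduce = trans (cong (λ m → iter σ m i) (m≡m%n+[m/n]*n k (suc p)))
                  (trans (iter-+ r (k / suc p * suc p) i)
                    (cong (iter σ r) (iter-* (suc p) (k / suc p) i e)))

      cycMin-≤ : ∀ {i j} → CycMin σ i → i ⇝ j → i F.≤ j
      cycMin-≤ min i⇝j with ⇝-short i⇝j
      ... | k , refl = ℕₚ.≮⇒≥ (min k)

      cycMin-unique : ∀ {i j} → CycMin σ i → CycMin σ j → i ⇝ j → i ≡ j
      cycMin-unique mi mj i⇝j = Fₚ.toℕ-injective
        (ℕₚ.≤-antisym (cycMin-≤ mi i⇝j) (cycMin-≤ mj (⇝-sym i⇝j)))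

      cycMin-exists : ∀ i → ∃ λ m → CycMin σ m × i ⇝ m
      cycMin-exists i = descend (toℕ i) i ℕₚ.≤-refl
        where
        descend : ∀ b j → toℕ j ≤ b → ∃ λ m → CycMin σ m × j ⇝ m
        descend b j j≤b with Fₚ.any? (λ k → _<F?_ σ (iter σ (toℕ k) j) j)
        ... | no ∄ = j , (λ k lt → ∄ (k , lt)) , ⇝-refl
        descend zero j j≤b | yes (k , lt) = ⊥-elim (ℕₚ.n≮0 (ℕₚ.<-≤-trans lt j≤b))
        descend (suc b) j j≤b | yes (k , lt) with descend b (iter σ (toℕ k) j) (ℕ.s≤s⁻¹ (ℕₚ.<-≤-trans lt j≤b))
        ... | m , min , r = m , min , ⇝-trans (toℕ k , refl) r

  -- Deleting an element, and the effect on cycles.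

  -- τ arises from σ by deleting d from its cycle; the remaining elements are
  -- relabelled through punchIn d.
  record Del {n} (d : Fin (suc n)) (σ : Vec (Fin (suc n)) (suc n)) (τ : Vec (Fin n) n) : Set where
    field
      keep   : ∀ j → lookup σ (punchIn d j) ≢ d → punchIn d (lookup τ j) ≡ lookup σ (punchIn d j)
      bypass : ∀ j → lookup σ (punchIn d j) ≡ d → punchIn d (lookup τ j) ≡ lookup σ d

  module _ {n} {d : Fin (suc n)} {σ : Vec (Fin (suc n)) (suc n)} {τ : Vec (Fin n) n}
           (σ-perm : Perm σ) (τ-perm : Perm τ) (del : Del d σ τ) where
    open Del del
    private ψ = punchIn d

    step⇒ : ∀ j → _⇝_ σ (ψ j) (ψ (lookup τ j))
    step⇒ j with lookup σ (ψ j) F.≟ d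
    ... | no ≢d = 1 , sym (keep j ≢d)
    ... | yes ≡d = 2 , trans (cong (lookup σ) ≡d) (sym (bypass j ≡d))

    orbit⇒ : ∀ k j → _⇝_ σ (ψ j) (ψ (iter τ k j))
    orbit⇒ zero    j = ⇝-refl σ
    orbit⇒ (suc k) j = ⇝-trans σ (orbit⇒ k j) (step⇒ (iter τ k j))

    -- A passage through d costs two steps of σ but only one of τ, hence the strong induction on the
    -- number of steps.
    orbit⇐ : ∀ k {i j} → iter σ k (ψ i) ≡ ψ j → _⇝_ τ i j
    orbit⇐ = <-rec _ go
      where
      go : ∀ k → (∀ {l} → l < k → ∀ {i j} → iter σ l (ψ i) ≡ ψ j → _⇝_ τ i j) → ∀ {i j} → iter σ k (ψ i) ≡ ψ j → _⇝_ τ i j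
      go zero rec {i} {j} e = 0 , Fₚ.punchIn-injective d i j e
      go (suc k) rec {i} {j} e with lookup σ (ψ i) F.≟ d
      ... | no ≢d = ⇝-trans τ (1 , refl) (rec (ℕₚ.n<1+n k)
                      (trans (cong (iter σ k) (keep i ≢d)) (trans (sym (iter-suc σ k (ψ i))) e)))
      go (suc zero) rec {i} {j} e | yes ≡d = ⊥-elim (Fₚ.punchInᵢ≢i d j (trans (sym e) ≡d))
      go (suc (suc k)) rec {i} {j} e | yes ≡d = ⇝-trans τ (1 , refl) (rec (ℕₚ.<-trans (ℕₚ.n<1+n k) (ℕₚ.n<1+n (suc k)))
          (trans (cong (iter σ k) (trans (bypass i ≡d) (cong (lookup σ) (sym ≡d))))
          (trans (sym (iter-suc σ k _)) (trans (sym (iter-suc σ (suc k) (ψ i))) e))))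

    -- A cycle of τ, named by its minimum, is matched with the cycle of σ containing
    -- its image; `nothing` stands for the cycle {d} when d is fixed.
    private
      data SameCycle : Fin (suc n) → Maybe (Fin n) → Set where
        lost   : lookup σ d ≡ d → SameCycle d nothing
        shared : ∀ {i j} → CycMin σ i → CycMin τ j → _⇝_ σ (ψ j) i → SameCycle i (just j)

      fixed-alone : lookup σ d ≡ d → ∀ {i} → _⇝_ σ d i → i ≡ d
      fixed-alone fix (zero , refl) = refl
      fixed-alone fix (suc k , refl) = trans (cong (lookup σ) (fixed-alone fix (k , refl))) fix

      no-clash : lookup σ d ≡ d → ∀ {j} → ¬ (_⇝_ σ (ψ j) d)
      no-clash fix r = Fₚ.punchInᵢ≢i d _ (fixed-alone fix (⇝-sym σ σ-perm r))

      fun : ∀ {x y y'} → SameCycle x y → SameCycle x y' → y ≡ y'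
      fun (lost _) (lost _) = refl
      fun (lost f) (shared _ _ r) = ⊥-elim (no-clash f r)
      fun (shared _ _ r) (lost f) = ⊥-elim (no-clash f r)
      fun (shared _ m r) (shared _ m' r') with ⇝-trans σ r (⇝-sym σ σ-perm r')
      ... | k , e = cong just (cycMin-unique τ τ-perm m m' (orbit⇐ k e))

      injective : ∀ {x x' y} → SameCycle x y → SameCycle x' y → x ≡ x'
      injective (lost _) (lost _) = refl
      injective (shared m _ r) (shared m' _ r') = cycMin-unique σ σ-perm m m' (⇝-trans σ (⇝-sym σ σ-perm r) r')

      mins : ∀ {m} (ρ : Vec (Fin m) m) → List (Fin m)
      mins ρ = filter (cycMin? ρ) (allFin _)

      mins-unique : ∀ {m} (ρ : Vec (Fin m) m) → Unique (mins ρ)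
      mins-unique ρ = Uₚ.filter⁺ (cycMin? ρ) (Uₚ.allFin⁺ _)

      ∈-mins : ∀ {m} (ρ : Vec (Fin m) m) {i} → CycMin ρ i → i ∈ mins ρ
      ∈-mins ρ m = ∈ₚ.∈-filter⁺ (cycMin? ρ) (∈ₚ.∈-allFin _) m

      just-∈-mins : ∀ {j} → CycMin τ j → just j ∈ L.map just (mins τ)
      just-∈-mins m = ∈ₚ.∈-map⁺ just (∈-mins τ m)

      from-σ : ∀ {i j} → CycMin σ i → _⇝_ σ (ψ j) i → ∃ λ y → y ∈ L.map just (mins τ) × SameCycle i y
      from-σ {i} {j} mi r with cycMin-exists τ τ-perm j
      ... | m , mm , (k , refl) = just m , just-∈-mins mm ,
              shared mi mm (⇝-trans σ (⇝-sym σ σ-perm (orbit⇒ k j)) r)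

      from-τ : ∀ {j} → CycMin τ j → ∃ λ i → i ∈ mins σ × SameCycle i (just j)
      from-τ {j} mj with cycMin-exists σ σ-perm (ψ j)
      ... | m , mm , r = m , ∈-mins σ mm , shared mm mj r

      mins-just-unique : Unique (L.map just (mins τ))
      mins-just-unique = Uₚ.map⁺ Maybeₚ.just-injective (mins-unique τ)

    -- Since σ(d) survives, no cycle disappears; if d was the minimum of its cycle, the matching
    -- minimum in τ is found from σ(d).
    cyc-Del-moved : lookup σ d ≢ d → cyc σ ≡ cyc τ
    cyc-Del-moved moved = trans
      (matching-length SameCycle fun injective (mins-unique σ) mins-just-unique total onto)
      (Lₚ.length-map just (mins τ))
      where
      total : ∀ {i} → i ∈ mins σ → ∃ λ y → y ∈ L.map just (mins τ) × SameCycle i y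
      total {i} i∈ with ∈ₚ.∈-filter⁻ (cycMin? σ) {xs = allFin _} i∈ | i F.≟ d
      ... | _ , mi | no i≢d with punchIn-preimage i≢d
      ...   | j , refl = from-σ mi (⇝-refl σ)
      total {i} i∈ | _ , mi | yes refl with punchIn-preimage moved
      ...   | j , e = from-σ mi (⇝-sym σ σ-perm (1 , e))
      onto : ∀ {y} → y ∈ L.map just (mins τ) → ∃ λ i → i ∈ mins σ × SameCycle i y
      onto y∈ with ∈ₚ.∈-map⁻ just y∈
      ... | j , j∈ , refl = from-τ (proj₂ (∈ₚ.∈-filter⁻ (cycMin? τ) {xs = allFin _} j∈))

    cyc-Del-fixed : lookup σ d ≡ d → cyc σ ≡ suc (cyc τ)
    cyc-Del-fixed fix = trans
      (matching-length SameCycle fun injective (mins-unique σ) unique total onto)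
      (cong suc (Lₚ.length-map just (mins τ)))
      where
      unique : Unique (nothing ∷ L.map just (mins τ))
      unique = Allₚ.map⁺ (All.universal (λ _ ()) (mins τ)) ∷ mins-just-unique
      total : ∀ {i} → i ∈ mins σ → ∃ λ y → y ∈ nothing ∷ L.map just (mins τ) × SameCycle i y
      total {i} i∈ with ∈ₚ.∈-filter⁻ (cycMin? σ) {xs = allFin _} i∈ | i F.≟ d
      ... | _ , mi | yes refl = nothing , here refl , lost fix
      ... | _ , mi | no i≢d with punchIn-preimage i≢d
      ...   | j , refl with from-σ mi (⇝-refl σ)
      ...     | y , y∈ , r = y , there y∈ , r
      d-min : CycMin σ d
      d-min k lt = ℕₚ.<-irrefl (cong toℕ (fixed-alone fix (toℕ k , refl))) lt
      onto : ∀ {y} → y ∈ nothing ∷ L.map just (mins τ) → ∃ λ i → i ∈ mins σ × SameCycle i y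
      onto (here refl) = d , ∈-mins σ d-min , lost fix
      onto (there y∈) with ∈ₚ.∈-map⁻ just y∈
      ... | j , j∈ , refl = from-τ (proj₂ (∈ₚ.∈-filter⁻ (cycMin? τ) {xs = allFin _} j∈))

  lookup-extensional : ∀ {A : Set} {n} {v w : Vec A n} → (∀ i → lookup v i ≡ lookup w i) → v ≡ w
  lookup-extensional {v = v} {w} e =
    trans (sym (Vₚ.tabulate∘lookup v)) (trans (Vₚ.tabulate-cong e) (Vₚ.tabulate∘lookup w))

  -- Labels of indices, and their invariance under deletion.

  -- The Boolean records whether the index is an antirecord (peaks, falls) or a
  -- record (rises); the argument of fixᴸ is psnest.
  data Label : Set where
    fixᴸ                : ℕ → Label
    peakᴸ fallᴸ riseᴸ   : Bool → Label
    valleyᴸ             : Label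

  -- The cycle type is witnessed by a preimage p instead of `inv`, because a preimage can be
  -- followed through a deletion. With `Reflects` for the Boolean, transporting a label takes only
  -- an equivalence of the reflected statements.
  data HasLabel {n} (σ : Vec (Fin n) n) (i : Fin n) : Label → Set where
    fix    : lookup σ i ≡ i → HasLabel σ i (fixᴸ (psnest σ i))
    peak   : ∀ {p b} → lookup σ p ≡ i → p F.< i → lookup σ i F.< i → Reflects (AntiRecord σ i) b → HasLabel σ i (peakᴸ b)
    fall   : ∀ {p b} → lookup σ p ≡ i → i F.< p → lookup σ i F.< i → Reflects (AntiRecord σ i) b → HasLabel σ i (fallᴸ b)
    valley : ∀ {p} → lookup σ p ≡ i → i F.< p → i F.< lookup σ i → HasLabel σ i valleyᴸ
    rise   : ∀ {p b} → lookup σ p ≡ i → p F.< i → i F.< lookup σ i → Reflects (Record σ i) b → HasLabel σ i (riseᴸ b)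

  Reflects-map : ∀ {A B : Set} {b} → (A → B) → (B → A) → Reflects A b → Reflects B b
  Reflects-map f g (ofʸ a)  = ofʸ (f a)
  Reflects-map f g (ofⁿ ¬a) = ofⁿ (¬a ∘ g)

  reflected : ∀ {A : Set} (d : Dec A) → Reflects A (Dec.does d)
  reflected = Dec.proof

  hasLabel : ∀ {n} {σ : Vec (Fin n) n} → Perm σ → ∀ i → ∃ (HasLabel σ i)
  hasLabel {σ = σ} σ-perm i with Inj⇒surjective σ-perm i
  ... | p , σp≡i with ℕₚ.<-cmp (toℕ (lookup σ i)) (toℕ i) | ℕₚ.<-cmp (toℕ p) (toℕ i)
  ... | tri≈ _ e _ | _ = _ , fix (Fₚ.toℕ-injective e)
  ... | tri< lt _ _ | tri< p<i _ _ = _ , peak σp≡i p<i lt (reflected (antirecord? σ i))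
  ... | tri< lt _ _ | tri> _ _ i<p = _ , fall σp≡i i<p lt (reflected (antirecord? σ i))
  ... | tri> _ _ gt | tri> _ _ i<p = _ , valley σp≡i i<p gt
  ... | tri> _ _ gt | tri< p<i _ _ = _ , rise σp≡i p<i gt (reflected (record? σ i))
  ... | tri< lt _ _ | tri≈ _ e _ = ⊥-elim (ℕₚ.<⇒≢ lt (cong toℕ (trans (cong (lookup σ) (sym (Fₚ.toℕ-injective e))) σp≡i)))
  ... | tri> _ _ gt | tri≈ _ e _ = ⊥-elim (ℕₚ.<⇒≢ gt (sym (cong toℕ (trans (cong (lookup σ) (sym (Fₚ.toℕ-injective e))) σp≡i))))

  module _ {n} {d : Fin (suc n)} {σ : Vec (Fin (suc n)) (suc n)} {τ : Vec (Fin n) n}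
           (σ-perm : Perm σ) (τ-perm : Perm τ) (del : Del d σ τ) where
    open Del del
    private ψ = punchIn d

    -- Positions are matched by the value they carry. In the permutation diagram of a σ that moves
    -- d, the cell (σ⁻¹(d), d) disappears and the cell (d, σ(d)) moves to column σ⁻¹(d); if d is
    -- fixed, only its own cell disappears. All else is relabelling.
    data Corr : Fin (suc n) → Fin n → Set where
      same : ∀ {j} → lookup σ (ψ j) ≢ d → Corr (ψ j) j
      jump : ∀ {j} → lookup σ (ψ j) ≡ d → Corr d j

    Corr-value : ∀ {a j} → Corr a j → ψ (lookup τ j) ≡ lookup σ a
    Corr-value (same {j} ≢d) = keep j ≢d
    Corr-value (jump {j} ≡d) = bypass j ≡d

    Corr-total : ∀ {a} → lookup σ a ≢ d → ∃ (Corr a)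
    Corr-total {a} ≢d with a F.≟ d
    ... | no a≢d with punchIn-preimage a≢d
    ...   | j , refl = j , same ≢d
    Corr-total {a} ≢d | yes refl with Inj⇒surjective σ-perm d
    ... | p , e with punchIn-preimage {d = d} {i = p} (λ { refl → ≢d e })
    ...   | j , refl = j , jump e

    Corr-onto : ∀ j → ∃ λ a → Corr a j
    Corr-onto j with lookup σ (ψ j) F.≟ d
    ... | no ≢d = ψ j , same ≢d
    ... | yes ≡d = d , jump ≡d

    Corr-fun : ∀ {a j j'} → Corr a j → Corr a j' → j ≡ j'
    Corr-fun c c' = τ-perm _ _ (Fₚ.punchIn-injective d _ _ (trans (Corr-value c) (sym (Corr-value c'))))

    Corr-inj : ∀ {a a' j} → Corr a j → Corr a' j → a ≡ a'
    Corr-inj c c' = σ-perm _ _ (trans (sym (Corr-value c)) (Corr-value c'))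

    -- If the deleted element and its preimage both lie below i, nothing that
    -- i can see changes.
    module Above (i : Fin n) (d≤i : d F.≤ i) (pre : ∀ p → lookup σ p ≡ d → p F.< punchIn d i) where
      private I = punchIn d i

      d<I : d F.< I
      d<I = subst (toℕ d <_) (sym (toℕ-punchIn-≥ d≤i)) (s≤s d≤i)

      Corr-< : ∀ {a j} → Corr a j → a F.< I → j F.< i
      Corr-< (same _) lt = punchIn-cancel-< d lt
      Corr-< (jump ≡d) _ = punchIn-cancel-< d (pre _ ≡d)

      Corr-<⁻ : ∀ {a j} → Corr a j → j F.< i → a F.< I
      Corr-<⁻ (same _) lt = punchIn-mono-< d lt
      Corr-<⁻ (jump _) _ = d<I

      Corr-> : ∀ {a j} → Corr a j → I F.< a → i F.< j
      Corr-> (same _) lt = punchIn-cancel-< d lt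
      Corr-> (jump _) lt = ⊥-elim (ℕₚ.<-asym lt d<I)

      Corr->⁻ : ∀ {a j} → Corr a j → i F.< j → I F.< a
      Corr->⁻ (same _) lt = punchIn-mono-< d lt
      Corr->⁻ (jump ≡d) lt = ⊥-elim (ℕₚ.<-asym lt (punchIn-cancel-< d (pre _ ≡d)))

      above-≢ : ∀ {a} → I F.≤ a → lookup σ a ≢ d
      above-≢ I≤a e = ℕₚ.<⇒≱ (pre _ e) I≤a

      value : ψ (lookup τ i) ≡ lookup σ I
      value = keep i (above-≢ ℕₚ.≤-refl)

      Corr-value-< : ∀ {a j} → Corr a j → ∀ {k} → lookup σ a F.< ψ k → lookup τ j F.< k
      Corr-value-< c {k} lt = punchIn-cancel-< d (subst (F._< ψ k) (sym (Corr-value c)) lt)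

      Corr-value-> : ∀ {a j} → Corr a j → ∀ {k} → ψ k F.< lookup σ a → k F.< lookup τ j
      Corr-value-> c {k} lt = punchIn-cancel-< d (subst (ψ k F.<_) (sym (Corr-value c)) lt)

      Corr-value-<⁻ : ∀ {a j} → Corr a j → ∀ {k} → lookup τ j F.< k → lookup σ a F.< ψ k
      Corr-value-<⁻ c {k} lt = subst (F._< ψ k) (Corr-value c) (punchIn-mono-< d lt)

      Corr-value->⁻ : ∀ {a j} → Corr a j → ∀ {k} → k F.< lookup τ j → ψ k F.< lookup σ a
      Corr-value->⁻ c {k} lt = subst (ψ k F.<_) (Corr-value c) (punchIn-mono-< d lt)

      τ-< : lookup σ I F.< I → lookup τ i F.< i
      τ-< lt = punchIn-cancel-< d (subst (F._< I) (sym value) lt)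

      τ-> : I F.< lookup σ I → i F.< lookup τ i
      τ-> lt = punchIn-cancel-< d (subst (I F.<_) (sym value) lt)

      antirecord⇒ : AntiRecord σ I → AntiRecord τ i
      antirecord⇒ anti j i<j with Corr-onto j
      ... | a , c = Corr-value-> c (subst (F._< lookup σ a) (sym value) (anti a (Corr->⁻ c i<j)))

      antirecord⇐ : AntiRecord τ i → AntiRecord σ I
      antirecord⇐ anti a I<a with Corr-total (above-≢ (ℕₚ.<⇒≤ I<a))
      ... | j , c = subst (F._< lookup σ a) value (Corr-value->⁻ c (anti j (Corr-> c I<a)))

      record⇒ : Record σ I → Record τ i
      record⇒ rec j j<i with Corr-onto j
      ... | a , c = Corr-value-< c (subst (lookup σ a F.<_) (sym value) (rec a (Corr-<⁻ c j<i)))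

      -- The cell of value d has no counterpart in τ; it cannot spoil a record at I because d < I <
      -- σ(I).
      record⇐ : I F.< lookup σ I → Record τ i → Record σ I
      record⇐ exc rec a a<I with lookup σ a F.≟ d
      ... | yes e = subst (F._< lookup σ I) (sym e) (ℕₚ.<-trans d<I exc)
      ... | no ≢d with Corr-total ≢d
      ...   | j , c = subst (lookup σ a F.<_) value (Corr-value-<⁻ c (rec j (Corr-< c a<I)))

      psnest-Del : psnest σ I ≡ psnest τ i
      psnest-Del = matching-length Corr Corr-fun Corr-inj
        (Uₚ.filter⁺ nests-σ? (Uₚ.allFin⁺ _)) (Uₚ.filter⁺ nests-τ? (Uₚ.allFin⁺ _)) total onto
        where
        nests-σ? = λ a → _×-dec_ (_<F?_ σ a I) (_<F?_ σ I (lookup σ a))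
        nests-τ? = λ j → _×-dec_ (_<F?_ τ j i) (_<F?_ τ i (lookup τ j))
        total : ∀ {a} → a ∈ filter nests-σ? (allFin _) → ∃ λ j → j ∈ filter nests-τ? (allFin _) × Corr a j
        total a∈ with ∈ₚ.∈-filter⁻ nests-σ? {xs = allFin _} a∈
        ... | _ , a<I , I<σa with Corr-total (λ e → ℕₚ.<-asym d<I (subst (I F.<_) e I<σa))
        ...   | j , c = j , ∈ₚ.∈-filter⁺ nests-τ? (∈ₚ.∈-allFin j) (Corr-< c a<I , Corr-value-> c I<σa) , c
        onto : ∀ {j} → j ∈ filter nests-τ? (allFin _) → ∃ λ a → a ∈ filter nests-σ? (allFin _) × Corr a j
        onto {j} j∈ with ∈ₚ.∈-filter⁻ nests-τ? {xs = allFin _} j∈ | Corr-onto j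
        ... | _ , j<i , i<τj | a , c =
          a , ∈ₚ.∈-filter⁺ nests-σ? (∈ₚ.∈-allFin a) (Corr-<⁻ c j<i , Corr-value->⁻ c i<τj) , c

      preimage : ∀ {p} → lookup σ p ≡ I → ∃ λ q → Corr p q × lookup τ q ≡ i
      preimage {p} e with Corr-total {p} (λ e' → Fₚ.punchInᵢ≢i d i (trans (sym e) e'))
      ... | q , c = q , c , Fₚ.punchIn-injective d _ _ (trans (Corr-value c) e)

      HasLabel-Del : ∀ {l} → HasLabel σ I l → HasLabel τ i l
      HasLabel-Del (fix e) = subst (HasLabel τ i ∘ fixᴸ) (sym psnest-Del)
        (fix (Fₚ.punchIn-injective d _ _ (trans value e)))
      HasLabel-Del (peak e lt v r) with preimage e
      ... | q , c , e' = peak e' (Corr-< c lt) (τ-< v) (Reflects-map antirecord⇒ antirecord⇐ r)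
      HasLabel-Del (fall e gt v r) with preimage e
      ... | q , c , e' = fall e' (Corr-> c gt) (τ-< v) (Reflects-map antirecord⇒ antirecord⇐ r)
      HasLabel-Del (valley e gt v) with preimage e
      ... | q , c , e' = valley e' (Corr-> c gt) (τ-> v)
      HasLabel-Del (rise e lt v r) with preimage e
      ... | q , c , e' = rise e' (Corr-< c lt) (τ-> v) (Reflects-map record⇒ (record⇐ v) r)

  -- The datum that a deletion loses: the predecessor of d in the labels of τ, with `nothing` for a
  -- fixed d. Together with τ it determines σ.
  Before : ∀ {n} → Maybe (Fin n) → Fin (suc n) → Vec (Fin (suc n)) (suc n) → Set
  Before nothing  d σ = lookup σ d ≡ d
  Before (just p) d σ = lookup σ (punchIn d p) ≡ d

  -- Existence and uniqueness of deletions and insertions.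

  Fin-choice : ∀ {n} {B : Set} (P : Fin n → B → Set) → (∀ i → ∃ (P i)) → ∃ λ (v : Vec B n) → ∀ i → P i (lookup v i)
  Fin-choice P c = tabulate (proj₁ ∘ c) ,
    λ i → subst (P i) (sym (Vₚ.lookup∘tabulate (proj₁ ∘ c) i)) (proj₂ (c i))

  Del-exists : ∀ {n} {σ : Vec (Fin (suc n)) (suc n)} → Perm σ → ∀ d → ∃ λ τ → Perm τ × Del d σ τ
  Del-exists {n} {σ} σ-perm d = τ , τ-perm , del
    where
    Spec : Fin n → Fin n → Set
    Spec j v = (lookup σ (punchIn d j) ≢ d → punchIn d v ≡ lookup σ (punchIn d j))
             × (lookup σ (punchIn d j) ≡ d → punchIn d v ≡ lookup σ d)
    value : ∀ j → ∃ (Spec j)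
    value j with lookup σ (punchIn d j) F.≟ d
    ... | no ≢d with punchIn-preimage ≢d
    ...   | v , e = v , (λ _ → sym e) , ⊥-elim ∘ ≢d
    value j | yes ≡d with punchIn-preimage {i = lookup σ d} (λ e → Fₚ.punchInᵢ≢i d j (σ-perm _ _ (trans ≡d (sym e))))
    ...   | v , e = v , (λ ≢d → ⊥-elim (≢d ≡d)) , λ _ → sym e
    τ = proj₁ (Fin-choice Spec value)
    spec = proj₂ (Fin-choice Spec value)
    del : Del d σ τ
    del = record { keep = proj₁ ∘ spec ; bypass = proj₂ ∘ spec }
    τ-perm : Perm τ
    τ-perm i j e with lookup σ (punchIn d i) F.≟ d | lookup σ (punchIn d j) F.≟ d
    ... | yes a | yes b = Fₚ.punchIn-injective d i j (σ-perm _ _ (trans a (sym b)))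
    ... | no a | no b = Fₚ.punchIn-injective d i j (σ-perm _ _
            (trans (sym (proj₁ (spec i) a)) (trans (cong (punchIn d) e) (proj₁ (spec j) b))))
    ... | yes a | no b = ⊥-elim (Fₚ.punchInᵢ≢i d j (sym (σ-perm _ _
            (trans (sym (proj₂ (spec i) a)) (trans (cong (punchIn d) e) (proj₁ (spec j) b))))))
    ... | no a | yes b = ⊥-elim (Fₚ.punchInᵢ≢i d i (σ-perm _ _
            (trans (sym (proj₁ (spec i) a)) (trans (cong (punchIn d) e) (proj₂ (spec j) b)))))

  Del-unique : ∀ {n} {d : Fin (suc n)} {σ τ τ'} → Del {n} d σ τ → Del d σ τ' → τ ≡ τ'
  Del-unique {d = d} {σ} D D' = lookup-extensional λ j → Fₚ.punchIn-injective d _ _ (agree j)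
    where
    agree : ∀ j → _
    agree j with lookup σ (punchIn d j) F.≟ d
    ... | no ≢d  = trans (Del.keep D j ≢d) (sym (Del.keep D' j ≢d))
    ... | yes ≡d = trans (Del.bypass D j ≡d) (sym (Del.bypass D' j ≡d))

  Del-kept : ∀ {n m} {d : Fin (suc n)} {σ τ} → Perm σ → Del {n} d σ τ → Before m d σ
    → ∀ j → m ≢ just j → punchIn d (lookup τ j) ≡ lookup σ (punchIn d j)
  Del-kept {m = nothing} {d} p D e j _ = Del.keep D j λ e' → Fₚ.punchInᵢ≢i d j (p _ _ (trans e' (sym e)))
  Del-kept {m = just q} {d} p D e j q≢j = Del.keep D j λ e' → q≢j (cong just (Fₚ.punchIn-injective d _ _ (p _ _ (trans e (sym e')))))

  Ins-unique : ∀ {n m} {d : Fin (suc n)} {σ σ' τ} → Perm σ → Perm σ' → Del {n} d σ τ → Del d σ' τ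
    → Before m d σ → Before m d σ' → σ ≡ σ'
  Ins-unique {m = m} {d} {σ} {σ'} {τ} p p' D D' b b' = lookup-extensional agree
    where
    moved : ∀ m j → m ≡ just j → Before m d σ → Before m d σ' → lookup σ (punchIn d j) ≡ lookup σ' (punchIn d j)
    moved _ j refl b b' = trans b (sym b')
    atd : ∀ m → Before m d σ → Before m d σ' → lookup σ d ≡ lookup σ' d
    atd nothing b b' = trans b (sym b')
    atd (just q) b b' = trans (sym (Del.bypass D q b)) (Del.bypass D' q b')
    agree : ∀ i → lookup σ i ≡ lookup σ' i
    agree i with i F.≟ d
    ... | yes refl = atd m b b'
    ... | no i≢d with punchIn-preimage i≢d
    ...   | j , refl with Maybeₚ.≡-dec F._≟_ m (just j)
    ...     | yes e = moved m j e b b'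
    ...     | no m≢j = trans (sym (Del-kept {m = m} p D b j m≢j)) (Del-kept {m = m} p' D' b' j m≢j)

  Ins-exists : ∀ {n} {τ : Vec (Fin n) n} → Perm τ → ∀ d m → ∃ λ σ → Perm σ × Del d σ τ × Before m d σ
  Ins-exists {n} {τ} τ-perm d nothing = σ , σ-perm , del , at-d
    where
    Spec : Fin (suc n) → Fin (suc n) → Set
    Spec i v = (i ≡ d → v ≡ d) × (∀ j → i ≡ punchIn d j → v ≡ punchIn d (lookup τ j))
    value : ∀ i → ∃ (Spec i)
    value i with i F.≟ d
    ... | yes refl = d , (λ _ → refl) , λ j e → ⊥-elim (Fₚ.punchInᵢ≢i d j (sym e))
    ... | no i≢d with punchIn-preimage i≢d
    ...   | j , refl = punchIn d (lookup τ j) , ⊥-elim ∘ i≢d ,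
              λ j' e → cong (punchIn d ∘ lookup τ) (Fₚ.punchIn-injective d j j' e)
    σ = proj₁ (Fin-choice Spec value)
    spec = proj₂ (Fin-choice Spec value)
    at-d : lookup σ d ≡ d
    at-d = proj₁ (spec d) refl
    at-ψ : ∀ j → lookup σ (punchIn d j) ≡ punchIn d (lookup τ j)
    at-ψ j = proj₂ (spec _) j refl
    del : Del d σ τ
    del = record { keep = λ j _ → sym (at-ψ j)
                 ; bypass = λ j e → ⊥-elim (Fₚ.punchInᵢ≢i d _ (trans (sym (at-ψ j)) e)) }
    σ-perm : Perm σ
    σ-perm a b e with a F.≟ d | b F.≟ d
    ... | yes refl | yes refl = refl
    ... | yes refl | no b≢d with punchIn-preimage b≢d
    ...   | j , refl = ⊥-elim (Fₚ.punchInᵢ≢i d _ (trans (sym (at-ψ j)) (trans (sym e) at-d)))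
    σ-perm a b e | no a≢d | yes refl with punchIn-preimage a≢d
    ...   | j , refl = ⊥-elim (Fₚ.punchInᵢ≢i d _ (trans (sym (at-ψ j)) (trans e at-d)))
    σ-perm a b e | no a≢d | no b≢d with punchIn-preimage a≢d | punchIn-preimage b≢d
    ...   | j , refl | k , refl = cong (punchIn d) (τ-perm j k (Fₚ.punchIn-injective d _ _
              (trans (sym (at-ψ j)) (trans e (at-ψ k)))))
  Ins-exists {n} {τ} τ-perm d (just p) with Ins-exists {τ = τ} τ-perm d nothing
  ... | ρ , ρ-perm , fixed , ρd≡d = σ , σ-perm , del , at-p
    where
    q = punchIn d p
    q≢d = Fₚ.punchInᵢ≢i d p
    -- Since ρ fixes d, exchanging the arguments d and q inserts d right after q in its cycle: q
    -- goes to d, and d to the former image of q.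
    σ = tabulate (lookup ρ ∘ transpose d q)
    σ≡ : ∀ i {j} → transpose d q i ≡ j → lookup σ i ≡ lookup ρ j
    σ≡ i e = trans (Vₚ.lookup∘tabulate (lookup ρ ∘ transpose d q) i) (cong (lookup ρ) e)
    transpose-d : transpose d q d ≡ q
    transpose-d rewrite dec-true (d F.≟ d) refl = refl
    transpose-q : transpose d q q ≡ d
    transpose-q rewrite dec-false (q F.≟ d) q≢d | dec-true (q F.≟ q) refl = refl
    transpose-other : ∀ {i} → i ≢ d → i ≢ q → transpose d q i ≡ i
    transpose-other {i} i≢d i≢q rewrite dec-false (i F.≟ d) i≢d | dec-false (i F.≟ q) i≢q = refl
    at-p : lookup σ q ≡ d
    at-p = trans (σ≡ q transpose-q) ρd≡d
    at-ρ : ∀ j → punchIn d (lookup τ j) ≡ lookup ρ (punchIn d j)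
    at-ρ j = Del-kept {m = nothing} ρ-perm fixed ρd≡d j λ ()
    σ-perm : Perm σ
    σ-perm i j e = trans (sym (transpose-inverse q d {i}))
      (trans (cong (transpose q d) (ρ-perm (transpose d q i) (transpose d q j) (trans (sym (σ≡ i refl)) (trans e (σ≡ j refl))))) (transpose-inverse q d {j}))
    del : Del d σ τ
    del = record
      { keep   = λ j ≢d → trans (at-ρ j) (sym (σ≡ (punchIn d j) (transpose-other (Fₚ.punchInᵢ≢i d j)
                   (λ e → ≢d (trans (cong (lookup σ) e) at-p)))))
      ; bypass = λ j e → trans (cong (punchIn d ∘ lookup τ) (Fₚ.punchIn-injective d j p (σ-perm (punchIn d j) q (trans e (sym at-p)))))
                   (trans (at-ρ p) (sym (σ≡ d transpose-d)))
      }

  -- The enumeration of all permutations.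

  concatMap-product : ∀ {A B C : Set} (f : A → B → C) xs ys
    → concatMap (λ x → L.map (f x) ys) xs ≡ cartesianProductWith f xs ys
  concatMap-product f []       ys = refl
  concatMap-product f (x ∷ xs) ys = cong (L.map (f x) ys ++_) (concatMap-product f xs ys)

  allVecs-complete : ∀ {m k} (v : Vec (Fin k) m) → v ∈ allVecs m k
  allVecs-complete V.[] = here refl
  allVecs-complete {suc m} {k} (i V.∷ v) =
    subst (i V.∷ v ∈_) (sym (concatMap-product V._∷_ (allFin k) (allVecs m k)))
      (∈ₚ.∈-cartesianProductWith⁺ V._∷_ (∈ₚ.∈-allFin i) (allVecs-complete v))

  allVecs-unique : ∀ m k → Unique (allVecs m k)
  allVecs-unique zero    k = [] ∷ []
  allVecs-unique (suc m) k = subst Unique (sym (concatMap-product V._∷_ (allFin k) (allVecs m k)))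
    (Uₚ.cartesianProductWith⁺ V._∷_ Vₚ.∷-injective (Uₚ.allFin⁺ k) (allVecs-unique m k))

  Sym-unique : ∀ n → Unique (Sym n)
  Sym-unique n = Uₚ.filter⁺ Injective? (allVecs-unique n n)

  ∈-Sym⁺ : ∀ {n} {σ : Vec (Fin n) n} → Perm σ → σ ∈ Sym n
  ∈-Sym⁺ p = ∈ₚ.∈-filter⁺ Injective? (allVecs-complete _) p

  ∈-Sym⁻ : ∀ {n} {σ : Vec (Fin n) n} → σ ∈ Sym n → Perm σ
  ∈-Sym⁻ {n} σ∈ = proj₂ (∈ₚ.∈-filter⁻ Injective? {xs = allVecs n n} σ∈)

  -- States of the scan and a single step on them.

  -- The permutations of [n] satisfying Escapes h, read on the indices ≥ h, are the
  -- states of the scan: each r < h stands for a path of the already scanned part.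
  Escapes : ∀ {n} → ℕ → Vec (Fin n) n → Set
  Escapes h σ = ∀ r → toℕ r < h → h ≤ toℕ (lookup σ r)

  escapes? : ∀ {n} h → Decidable (Escapes {n} h)
  escapes? h σ = Fₚ.all? λ r → (toℕ r ℕₚ.<? h) →-dec (h ℕₚ.≤? toℕ (lookup σ r))

  module _ {n} (H : Fin (suc n)) where

    NonFall Fixing : Vec (Fin (suc n)) (suc n) → Set
    NonFall σ = Escapes (toℕ H) σ × H F.≤ lookup σ H
    Fixing  σ = Escapes (toℕ H) σ × lookup σ H ≡ H

    Rising : Fin n → Vec (Fin (suc n)) (suc n) → Set
    Rising q σ = Escapes (toℕ H) σ × lookup σ (punchIn H q) ≡ H × H F.< lookup σ H

    Falling : Fin (suc n) → Vec (Fin (suc n)) (suc n) → Set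
    Falling r σ = Escapes (toℕ H) σ × lookup σ H ≡ r

    nonFall? : Decidable NonFall
    nonFall? σ = escapes? (toℕ H) σ ×-dec (H F.≤? lookup σ H)
    fixing? : Decidable Fixing
    fixing? σ = escapes? (toℕ H) σ ×-dec (lookup σ H F.≟ H)
    rising? : ∀ q → Decidable (Rising q)
    rising? q σ = escapes? (toℕ H) σ ×-dec (lookup σ (punchIn H q) F.≟ H) ×-dec (H F.<? lookup σ H)
    falling? : ∀ r → Decidable (Falling r)
    falling? r σ = escapes? (toℕ H) σ ×-dec (lookup σ H F.≟ r)

    escapes-suc⁻ : ∀ {σ} → Escapes (suc (toℕ H)) σ → Escapes (toℕ H) σ × H F.< lookup σ H
    escapes-suc⁻ e = (λ r r<h → ℕₚ.<⇒≤ (e r (ℕₚ.m<n⇒m<1+n r<h))) , e H ℕₚ.≤-refl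

    escapes-suc⁺ : ∀ {σ} → Escapes (toℕ H) σ → H F.< lookup σ H
      → (∀ r → r F.< H → lookup σ r ≢ H) → Escapes (suc (toℕ H)) σ
    escapes-suc⁺ {σ} e exc miss r r≤h with ℕₚ.m≤n⇒m<n∨m≡n (ℕ.s≤s⁻¹ r≤h)
    ... | inj₁ r<h = ℕₚ.≤∧≢⇒< (e r r<h) (λ e' → miss r r<h (Fₚ.toℕ-injective (sym e')))
    ... | inj₂ r≡h with Fₚ.toℕ-injective r≡h
    ...   | refl = exc

    data NonFallCase (σ : Vec (Fin (suc n)) (suc n)) : Set where
      isValley : Escapes (suc (toℕ H)) σ → NonFallCase σ
      isFixed  : lookup σ H ≡ H → NonFallCase σ
      isRise   : ∀ q → toℕ q < toℕ H → lookup σ (punchIn H q) ≡ H → H F.< lookup σ H → NonFallCase σ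

    nonFallCase : ∀ {σ} → Perm σ → NonFall σ → NonFallCase σ
    nonFallCase {σ} σ-perm (e , le) with ℕₚ.m≤n⇒m<n∨m≡n le
    ... | inj₂ h≡ = isFixed (sym (Fₚ.toℕ-injective h≡))
    ... | inj₁ exc with Inj⇒surjective σ-perm H
    ...   | p , σp≡H with ℕₚ.<-cmp (toℕ p) (toℕ H)
    ...     | tri≈ _ p≡H _ = isFixed (trans (cong (lookup σ) (sym (Fₚ.toℕ-injective p≡H))) σp≡H)
    ...     | tri> _ _ H<p = isValley (escapes-suc⁺ {σ} e exc λ r r<H σr≡H →
                ℕₚ.<-asym r<H (subst (H F.<_) (σ-perm _ _ (trans σp≡H (sym σr≡H))) H<p))
    ...     | tri< p<H p≢H _ with punchIn-preimage {d = H} {i = p} (λ { refl → p≢H refl })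
    ...       | q , refl = isRise q (below (toℕ-punchIn H q)) σp≡H exc
      where
      below : _ → toℕ q < toℕ H
      below (inj₁ (lt , _)) = lt
      below (inj₂ (_ , eq)) = ℕₚ.<-trans (ℕₚ.n<1+n _) (subst (_< toℕ H) eq p<H)

  ≤-punchIn⁻ : ∀ {n} {d : Fin (suc n)} {v : Fin n} → toℕ d ≤ toℕ (punchIn d v) → toℕ d ≤ toℕ v
  ≤-punchIn⁻ {d = d} {v} le with toℕ-punchIn d v
  ... | inj₁ (lt , eq) = ⊥-elim (ℕₚ.<⇒≱ lt (subst (toℕ d ≤_) eq le))
  ... | inj₂ (le' , _) = le'

  ≤-punchIn⁺ : ∀ {n} (d : Fin (suc n)) (v : Fin n) → toℕ v ≤ toℕ (punchIn d v)
  ≤-punchIn⁺ d v with toℕ-punchIn d v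
  ... | inj₁ (_ , eq) = ℕₚ.≤-reflexive (sym eq)
  ... | inj₂ (_ , eq) = ℕₚ.≤-trans (ℕₚ.n≤1+n _) (ℕₚ.≤-reflexive (sym eq))

  punchIn-≤-suc : ∀ {n} (d : Fin (suc n)) (v : Fin n) → toℕ (punchIn d v) ≤ suc (toℕ v)
  punchIn-≤-suc d v with toℕ-punchIn d v
  ... | inj₁ (_ , eq) = ℕₚ.≤-trans (ℕₚ.≤-reflexive eq) (ℕₚ.n≤1+n _)
  ... | inj₂ (_ , eq) = ℕₚ.≤-reflexive eq

  module _ {n} {H : Fin (suc n)} {σ : Vec (Fin (suc n)) (suc n)} {τ : Vec (Fin n) n} (del : Del H σ τ) where
    open Del del

    -- An early index either has a value above H, which drops by one and stays at least h, or points
    -- to H and inherits σ(H), which does not fall.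
    escapes-delete : H F.≤ lookup σ H → Escapes (toℕ H) σ → Escapes (toℕ H) τ
    escapes-delete H≤ e j j<H with lookup σ (punchIn H j) F.≟ H
    ... | yes ≡H = ≤-punchIn⁻ (subst (H F.≤_) (sym (bypass j ≡H)) H≤)
    ... | no ≢H = ≤-punchIn⁻ (subst (H F.≤_) (sym (keep j ≢H))
                    (e (punchIn H j) (subst (_< toℕ H) (sym (toℕ-punchIn-< j<H)) j<H)))

    escapes-insert : Escapes (toℕ H) τ → Escapes (toℕ H) σ
    escapes-insert e r r<H with punchIn-preimage {d = H} {i = r} (λ { refl → ℕₚ.<-irrefl refl r<H })
    ... | j , refl with lookup σ (punchIn H j) F.≟ H
    ...   | yes ≡H = ℕₚ.≤-reflexive (cong toℕ (sym ≡H))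
    ...   | no ≢H = subst (H F.≤_) (keep j ≢H)
              (ℕₚ.≤-trans (e j (ℕₚ.≤-<-trans (≤-punchIn⁺ H j) r<H)) (≤-punchIn⁺ H (lookup τ j)))

    exceeds-insert : ∀ q → toℕ q < toℕ H → lookup σ (punchIn H q) ≡ H → Escapes (toℕ H) τ → H F.< lookup σ H
    exceeds-insert q q<H ≡H e = subst (toℕ H <_) (trans (sym (toℕ-punchIn-≥ (e q q<H))) (cong toℕ (bypass q ≡H)))
      (s≤s (e q q<H))

  -- Deleting the value r = σ(H) < H from its cycle: H, relabelled, becomes p.
  module _ {n} {p : Fin (suc n)} {r : Fin (suc (suc n))} (r≤p : toℕ r ≤ toℕ p)
           {σ : Vec (Fin (suc (suc n))) (suc (suc n))} {τ : Vec (Fin (suc n)) (suc n)}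
           (σ-perm : Perm σ) (del : Del r σ τ) (σH≡r : lookup σ (suc p) ≡ r) where
    open Del del

    H≡punchIn : punchIn r p ≡ suc p
    H≡punchIn = Fₚ.toℕ-injective (toℕ-punchIn-≥ r≤p)

    private
      bypass-H : punchIn r (lookup τ p) ≡ lookup σ r
      bypass-H = bypass p (trans (cong (lookup σ) H≡punchIn) σH≡r)

      keep′ : ∀ j → j ≢ p → punchIn r (lookup τ j) ≡ lookup σ (punchIn r j)
      keep′ j j≢p = keep j λ e → j≢p (Fₚ.punchIn-injective r j p
        (trans (σ-perm _ _ (trans e (sym σH≡r))) (sym H≡punchIn)))

      raise : ∀ {v} → toℕ p ≤ toℕ v → suc (toℕ p) ≤ toℕ (punchIn r v)
      raise le = subst (suc (toℕ p) ≤_) (sym (toℕ-punchIn-≥ (ℕₚ.≤-trans r≤p le))) (s≤s le)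

    -- Early values are at least p + 1 and drop by at most one. The index r is itself early, and its
    -- value passes to p; so p does not fall in τ.
    falling-delete : Escapes (suc (toℕ p)) σ → NonFall p τ
    falling-delete e = (λ j j<p → bound (subst (suc (toℕ p) ≤_) (cong toℕ (sym (keep′ j λ { refl → ℕₚ.<-irrefl refl j<p })))
        (e (punchIn r j) (ℕₚ.≤-<-trans (punchIn-≤-suc r j) (s<s j<p)))))
      , bound (subst (suc (toℕ p) ≤_) (cong toℕ (sym bypass-H)) (e r (s≤s r≤p)))
      where
      bound : ∀ {v} → suc (toℕ p) ≤ toℕ (punchIn r v) → toℕ p ≤ toℕ v
      bound {v} le = ℕ.s≤s⁻¹ (ℕₚ.≤-trans le (punchIn-≤-suc r v))

    falling-insert : NonFall p τ → Escapes (suc (toℕ p)) σ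
    falling-insert (e , p≤) a a≤p with a F.≟ r
    ... | yes refl = subst (suc (toℕ p) ≤_) (cong toℕ bypass-H) (raise p≤)
    ... | no a≢r with punchIn-preimage a≢r
    ...   | j , refl = subst (suc (toℕ p) ≤_) (cong toℕ (keep′ j j≢p)) (raise (e j (ℕₚ.≤∧≢⇒< j≤p (j≢p ∘ Fₚ.toℕ-injective))))
      where
      j≤p : toℕ j ≤ toℕ p
      j≤p = ℕₚ.≤-trans (≤-punchIn⁺ r j) (ℕ.s≤s⁻¹ a≤p)
      j≢p : j ≢ p
      j≢p refl = ℕₚ.<-irrefl (cong toℕ H≡punchIn) a≤p

    preimage-of-H : ∀ {s} → lookup τ s ≡ p → s ≢ p → lookup σ (punchIn r s) ≡ suc p
    preimage-of-H e s≢p = trans (sym (keep′ _ s≢p)) (trans (cong (punchIn r) e) H≡punchIn)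

    bypassed-to-H : lookup τ p ≡ p → lookup σ r ≡ suc p
    bypassed-to-H e = trans (sym bypass-H) (trans (cong (punchIn r) e) H≡punchIn)

  -- Record status of the scanned index.

  -- When the first h indices all escape, the values below h occur after position h.
  falling-antirecord⇔ : ∀ {n} {H r : Fin n} {σ} → Perm σ → Escapes (toℕ H) σ → lookup σ H ≡ r → r F.< H
    → (AntiRecord σ H → toℕ r ≡ 0) × (toℕ r ≡ 0 → AntiRecord σ H)
  falling-antirecord⇔ {suc n} {H} {r} {σ} σ-perm e σH≡r r<H = to , from
    where
    to : AntiRecord σ H → toℕ r ≡ 0
    to anti with r F.≟ zero
    ... | yes refl = refl
    ... | no r≢0 with Inj⇒surjective σ-perm zero
    ...   | z , σz≡0 with ℕₚ.<-cmp (toℕ z) (toℕ H)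
    ...     | tri< z<H _ _ = ⊥-elim (ℕₚ.<⇒≱ (ℕₚ.≤-<-trans z≤n r<H) (subst (λ v → toℕ H ≤ toℕ v) σz≡0 (e z z<H)))
    ...     | tri≈ _ z≡H _ = ⊥-elim (r≢0 (trans (sym σH≡r) (trans (cong (lookup σ) (sym (Fₚ.toℕ-injective z≡H))) σz≡0)))
    ...     | tri> _ _ H<z = ⊥-elim (ℕₚ.n≮0 (subst (λ v → lookup σ H F.< v) σz≡0 (anti z H<z)))
    from : toℕ r ≡ 0 → AntiRecord σ H
    from r≡0 j H<j = ℕₚ.≤∧≢⇒< (subst (_≤ toℕ (lookup σ j)) (sym (trans (cong toℕ σH≡r) r≡0)) z≤n)
      λ e' → ℕₚ.<⇒≢ H<j (cong toℕ (σ-perm _ _ (Fₚ.toℕ-injective e')))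

  MaxBelow : ∀ {n} → ℕ → Vec (Fin n) n → Fin n → Set
  MaxBelow h τ q = ∀ j → toℕ j < h → j ≢ q → lookup τ j F.< lookup τ q

  maxBelow? : ∀ {n} h (τ : Vec (Fin n) n) → Decidable (MaxBelow h τ)
  maxBelow? h τ q = Fₚ.all? λ j → (toℕ j ℕₚ.<? h) →-dec (¬? (j F.≟ q) →-dec (lookup τ j F.<? lookup τ q))

  maxBelow-exists : ∀ {n} (τ : Vec (Fin n) n) → Perm τ → ∀ h → suc h ≤ n → ∃ λ q → toℕ q < suc h × MaxBelow (suc h) τ q
  maxBelow-exists {suc n} τ p zero _ = zero , z<s , λ { zero _ ≢ → ⊥-elim (≢ refl) ; (suc j) (s≤s ()) _ }
  maxBelow-exists {suc n} τ p (suc h) le with maxBelow-exists τ p h (ℕₚ.<⇒≤ le)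
  ... | q , q≤h , max = choose (ℕₚ.<-cmp (toℕ (lookup τ q)) (toℕ (lookup τ new)))
    where
    new : Fin (suc n)
    new = F.fromℕ< le
    toℕ-new : toℕ new ≡ suc h
    toℕ-new = Fₚ.toℕ-fromℕ< le
    old : ∀ j → toℕ j < suc (suc h) → j ≢ new → toℕ j < suc h
    old j j≤ j≢ = ℕₚ.≤∧≢⇒< (ℕ.s≤s⁻¹ j≤) λ e → j≢ (Fₚ.toℕ-injective (trans e (sym toℕ-new)))
    new≢q : new ≢ q
    new≢q e = ℕₚ.<⇒≢ q≤h (trans (cong toℕ (sym e)) toℕ-new)
    choose : _ → ∃ λ q' → toℕ q' < suc (suc h) × MaxBelow (suc (suc h)) τ q'
    choose (tri< lt _ _) = new , subst (_< suc (suc h)) (sym toℕ-new) ℕₚ.≤-refl , λ j j≤ j≢ →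
      case j F.≟ q of λ { (yes refl) → lt ; (no j≢q) → ℕₚ.<-trans (max j (old j j≤ j≢) j≢q) lt }
    choose (tri≈ _ e _) = ⊥-elim (new≢q (p _ _ (sym (Fₚ.toℕ-injective e))))
    choose (tri> _ _ gt) = q , ℕₚ.m<n⇒m<1+n q≤h , λ j j≤ j≢q →
      case j F.≟ new of λ { (yes refl) → gt ; (no j≢) → max j (old j j≤ j≢) j≢q }

  maxBelow-unique : ∀ {n h} {τ : Vec (Fin n) n} {q q'} → toℕ q < h → toℕ q' < h → MaxBelow h τ q → MaxBelow h τ q' → q ≡ q'
  maxBelow-unique {q = q} {q'} q<h q'<h m m' with q F.≟ q'
  ... | yes e = e
  ... | no ≢ = ⊥-elim (ℕₚ.<-asym (m q' q'<h (≢ ∘ sym)) (m' q q<h ≢))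

  -- The value σ(H) passes to q, whose old value H lies below σ(H) anyway. Comparing σ(H) with the
  -- earlier values of σ is therefore a comparison of entries of τ.
  rising-record⇔ : ∀ {n} {H : Fin (suc n)} {q σ τ} → Perm σ → Del H σ τ → toℕ q < toℕ H → lookup σ (punchIn H q) ≡ H → H F.< lookup σ H
    → (MaxBelow (toℕ H) τ q → Record σ H) × (Record σ H → MaxBelow (toℕ H) τ q)
  rising-record⇔ {H = H} {q} {σ} {τ} σ-perm del q<H σq≡H exc = to , from
    where
    open Del del
    kept : ∀ j → j ≢ q → punchIn H (lookup τ j) ≡ lookup σ (punchIn H j)
    kept j j≢q = keep j λ e → j≢q (Fₚ.punchIn-injective H j q (σ-perm _ _ (trans e (sym σq≡H))))
    to : MaxBelow (toℕ H) τ q → Record σ H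
    to max a a<H with punchIn-preimage {d = H} {i = a} (λ { refl → ℕₚ.<-irrefl refl a<H })
    ... | j , refl with j F.≟ q
    ...   | yes refl = subst (F._< lookup σ H) (sym σq≡H) exc
    ...   | no j≢q = subst₂ F._<_ (kept j j≢q) (bypass q σq≡H)
              (punchIn-mono-< H (max j (ℕₚ.≤-<-trans (≤-punchIn⁺ H j) a<H) j≢q))
    from : Record σ H → MaxBelow (toℕ H) τ q
    from rec j j<H j≢q = punchIn-cancel-< H (subst₂ F._<_ (sym (kept j j≢q)) (sym (bypass q σq≡H))
      (rec (punchIn H j) (subst (_< toℕ H) (sym (toℕ-punchIn-< j<H)) j<H)))

  -- The inverse, and the exclusion of falling records.

  -- The local search loop of inv has no accessible name; it is recovered by unification.
  search : ∀ {n} → Vec (Fin n) n → Fin n → List (Fin n) → Fin n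
  inv≡search : ∀ {n} (σ : Vec (Fin n) n) i → inv σ i ≡ search σ i (allFin n)

  search = _
  inv≡search {n} σ i with allFin n
  ... | _ = refl

  search-hit : ∀ {n} (σ : Vec (Fin n) n) {i j} js → j ∈ js → lookup σ j ≡ i → lookup σ (search σ i js) ≡ i
  search-hit σ {i} (k ∷ js) j∈ e with lookup σ k F.≟ i
  ... | yes e' = e'
  search-hit σ (k ∷ js) (here refl) e | no ≢ = ⊥-elim (≢ e)
  search-hit σ (k ∷ js) (there j∈) e | no ≢ = search-hit σ js j∈ e

  inv-inverse : ∀ {n} {σ : Vec (Fin n) n} → Perm σ → ∀ i → lookup σ (inv σ i) ≡ i
  inv-inverse {n} {σ} σ-perm i with Inj⇒surjective σ-perm i
  ... | j , e = trans (cong (lookup σ) (inv≡search σ i)) (search-hit σ (allFin n) (∈ₚ.∈-allFin j) e)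

  -- A record at i would bound i + 1 distinct values by σ(i) < i. With the dual lemma this leaves
  -- one of the two tests in `ERec`, `EARec` and `NR` open for each type, which is why a `Label`
  -- carries a single Boolean.
  fall⇒¬record : ∀ {n} {σ : Vec (Fin n) n} {i} → Perm σ → lookup σ i F.< i → ¬ Record σ i
  fall⇒¬record {σ = σ} {i} σ-perm lt rec = ℕₚ.<⇒≱ lt (prefix-bound σ-perm i (lookup σ i) bound)
    where
    bound : ∀ j → j F.≤ i → lookup σ j F.≤ lookup σ i
    bound j j≤i with ℕₚ.m≤n⇒m<n∨m≡n j≤i
    ... | inj₁ j<i = ℕₚ.<⇒≤ (rec j j<i)
    ... | inj₂ j≡i = ℕₚ.≤-reflexive (cong (λ k → toℕ (lookup σ k)) (Fₚ.toℕ-injective j≡i))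

  -- The same count for the inverse: after an antirecord only larger values occur, so all values up
  -- to σ(i) sit at positions up to i.
  exceedance⇒¬antirecord : ∀ {n} {σ : Vec (Fin n) n} {i} → Perm σ → i F.< lookup σ i → ¬ AntiRecord σ i
  exceedance⇒¬antirecord {σ = σ} {i} σ-perm lt anti = ℕₚ.<⇒≱ lt (prefix-bound inv-injective (lookup σ i) i bound)
    where
    inv-injective : Inj (inv σ)
    inv-injective a b e = trans (sym (inv-inverse {σ = σ} σ-perm a)) (trans (cong (lookup σ) e) (inv-inverse {σ = σ} σ-perm b))
    bound : ∀ v → v F.≤ lookup σ i → inv σ v F.≤ i
    bound v v≤ = ℕₚ.≮⇒≥ λ i<inv → ℕₚ.<⇒≱ (subst (lookup σ i F.<_) (inv-inverse {σ = σ} σ-perm v) (anti _ i<inv)) v≤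

open Combinatorics

-- Conditional sums and products.

module Sums {c ℓ : Level} (R : CommutativeRing c ℓ) where
  open Ring R hiding (zero)
  open CMSum +-commutativeMonoid using (sum; sum-remove; sum-cong-≋; ∑-distrib-+)
  module Π = CMSum *-commutativeMonoid

  -- Cut-offs by a neutral element: `when` is meant for sums, `opt` for products.
  when opt : ∀ {a} {A : Set a} → Dec A → Carrier → Carrier
  when (yes _) x = x
  when (no _)  _ = 0#
  opt (yes _) x = x
  opt (no _)  _ = 1#

  when-yes : ∀ {A : Set} (A? : Dec A) {x} → A → when A? x ≈ x
  when-yes (yes _) _ = refl
  when-yes (no ¬a) a = ⊥-elim (¬a a)

  when-no : ∀ {A : Set} (A? : Dec A) {x} → ¬ A → when A? x ≈ 0#
  when-no (yes a) ¬a = ⊥-elim (¬a a)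
  when-no (no _)  _  = refl

  when-cong : ∀ {A : Set} (A? : Dec A) {x y} → (A → x ≈ y) → when A? x ≈ when A? y
  when-cong (yes a) e = e a
  when-cong (no _)  _ = refl

  when-⇔ : ∀ {A B : Set} (A? : Dec A) (B? : Dec B) {x} → (A → B) → (B → A) → when A? x ≈ when B? x
  when-⇔ (yes a) B? f g = sym (when-yes B? (f a))
  when-⇔ (no ¬a) B? f g = sym (when-no B? (¬a ∘ g))

  when-* : ∀ {A : Set} (A? : Dec A) {x y} → when A? x * y ≈ when A? (x * y)
  when-* (yes _) = refl
  when-* (no _)  = zeroˡ _

  opt-yes : ∀ {A : Set} (A? : Dec A) {x} → A → opt A? x ≈ x
  opt-yes (yes _) _ = refl
  opt-yes (no ¬a) a = ⊥-elim (¬a a)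

  opt-no : ∀ {A : Set} (A? : Dec A) {x} → ¬ A → opt A? x ≈ 1#
  opt-no (yes a) ¬a = ⊥-elim (¬a a)
  opt-no (no _)  _  = refl

  if-yes : ∀ {A : Set} (A? : Dec A) {x y} → A → (if Dec.does A? then x else y) ≈ x
  if-yes (yes _) _ = refl
  if-yes (no ¬a) a = ⊥-elim (¬a a)

  if-no : ∀ {A : Set} (A? : Dec A) {x y} → ¬ A → (if Dec.does A? then x else y) ≈ y
  if-no (yes a) ¬a = ⊥-elim (¬a a)
  if-no (no _)  _  = refl

  sum-zero : ∀ {n} (t : Fin n → Carrier) → (∀ i → t i ≈ 0#) → sum t ≈ 0#
  sum-zero {zero}  t e = refl
  sum-zero {suc n} t e = trans (+-cong (e zero) (sum-zero (t ∘ suc) (e ∘ suc))) (+-identityˡ 0#)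

  sum-single : ∀ {n} (t : Fin n → Carrier) i {x} → t i ≈ x → (∀ j → j ≢ i → t j ≈ 0#) → sum t ≈ x
  sum-single {suc n} t i e z = trans (sum-remove {i = i} t)
    (trans (+-cong e (sum-zero (t ∘ punchIn i) (λ j → z _ (Fₚ.punchInᵢ≢i i j)))) (+-identityʳ _))

  sum-*ʳ : ∀ {n} (t : Fin n → Carrier) x → sum t * x ≈ sum (λ i → t i * x)
  sum-*ʳ {zero}  t x = zeroˡ x
  sum-*ʳ {suc n} t x = trans (distribʳ x _ _) (+-congˡ (sum-*ʳ (t ∘ suc) x))

  sum-below : ∀ {n} h → h ≤ n → ∀ x → sum {n} (λ q → when (toℕ q ℕₚ.<? h) x) ≈ h · x
  sum-below {n} zero z≤n x = sum-zero {n} _ (λ q → when-no (toℕ q ℕₚ.<? 0) {x} ℕₚ.n≮0)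
  sum-below {suc n} (suc h) (s≤s le) x = +-congˡ (trans
    (sum-cong-≋ {n} (λ q → when-⇔ (suc (toℕ q) ℕₚ.<? suc h) (toℕ q ℕₚ.<? h) {x} ℕ.s≤s⁻¹ s<s))
    (sum-below h le x))

  -- The source of all brackets x + (n - 1) u in the coefficients. The marked index is the
  -- predecessor of largest value for a rise, and r = 0 for a fall.
  sum-below-marked : ∀ {n k} {P : Fin n → Set} (P? : Decidable P) q → toℕ q < suc k → suc k ≤ n → P q
    → (∀ j → toℕ j < suc k → P j → j ≡ q) → ∀ a b
    → sum (λ j → when (toℕ j ℕₚ.<? suc k) (if Dec.does (P? j) then a else b)) ≈ a + k · b
  sum-below-marked {suc n} {k} {P} P? q q≤k le Pq only a b = trans (sum-remove {i = q} term)
    (+-cong first (trans (sum-cong-≋ {n} rest) (sum-below k (ℕ.s≤s⁻¹ le) b)))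
    where
    term : Fin (suc n) → Carrier
    term j = when (toℕ j ℕₚ.<? suc k) (if Dec.does (P? j) then a else b)
    first = trans (when-yes (toℕ q ℕₚ.<? suc k) q≤k) (if-yes (P? q) Pq)
    down : ∀ j → toℕ (punchIn q j) < suc k → toℕ j < k
    down j lt with toℕ-punchIn q j
    ... | inj₁ (j<q , _) = ℕₚ.<-≤-trans j<q (ℕ.s≤s⁻¹ q≤k)
    ... | inj₂ (_ , eq) = ℕ.s≤s⁻¹ (≡.subst (_< suc k) eq lt)
    rest : ∀ j → when (toℕ (punchIn q j) ℕₚ.<? suc k) (if Dec.does (P? (punchIn q j)) then a else b)
               ≈ when (toℕ j ℕₚ.<? k) b
    rest j = trans
      (when-cong (toℕ (punchIn q j) ℕₚ.<? suc k) (λ lt → if-no (P? _) (Fₚ.punchInᵢ≢i q j ∘ only _ lt)))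
      (when-⇔ (toℕ (punchIn q j) ℕₚ.<? suc k) (toℕ j ℕₚ.<? k) (down j)
        (λ lt → ℕₚ.≤-<-trans (punchIn-≤-suc q j) (s<s lt)))

  module _ {A : Set} where

    ∑ : (A → Carrier) → List A → Carrier
    ∑ f xs = Σᴸ (map f xs)

    ∑-cong : ∀ {f g : A → Carrier} xs → (∀ {x} → x ∈ xs → f x ≈ g x) → ∑ f xs ≈ ∑ g xs
    ∑-cong []       e = refl
    ∑-cong (x ∷ xs) e = +-cong (e (here ≡.refl)) (∑-cong xs (e ∘ there))

    ∑-+ : ∀ {f g : A → Carrier} xs → ∑ (λ x → f x + g x) xs ≈ ∑ f xs + ∑ g xs
    ∑-+ []       = sym (+-identityˡ 0#)
    ∑-+ {f} {g} (x ∷ xs) = trans (+-congˡ (∑-+ xs))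
      (solve 4 (λ a b c d → (a :+ b) :+ (c :+ d) := (a :+ c) :+ (b :+ d)) refl (f x) (g x) (∑ f xs) (∑ g xs))
      where open Solver commutativeSemiring

    ∑-* : ∀ {f : A → Carrier} x xs → ∑ (λ a → x * f a) xs ≈ x * ∑ f xs
    ∑-* x []       = sym (zeroʳ x)
    ∑-* x (a ∷ xs) = trans (+-congˡ (∑-* x xs)) (sym (distribˡ x _ _))

    ∑-0 : ∀ xs → ∑ (λ _ → 0#) xs ≈ 0#
    ∑-0 []       = refl
    ∑-0 (x ∷ xs) = trans (+-identityˡ _) (∑-0 xs)

    ∑-sum : ∀ {n} (t : A → Fin n → Carrier) xs → ∑ (λ x → sum (t x)) xs ≈ sum (λ i → ∑ (λ x → t x i) xs)
    ∑-sum {n} t []       = sym (sum-zero {n} (λ _ → 0#) (λ _ → refl))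
    ∑-sum t (x ∷ xs) = trans (+-congˡ (∑-sum t xs)) (sym (∑-distrib-+ (t x) (λ i → ∑ (λ y → t y i) xs)))

    ∑-filter : ∀ {P : A → Set} (P? : Decidable P) (f : A → Carrier) xs
      → ∑ f (filter P? xs) ≈ ∑ (λ x → when (P? x) (f x)) xs
    ∑-filter P? f []       = refl
    ∑-filter P? f (x ∷ xs) with P? x
    ... | yes _ = +-congˡ (∑-filter P? f xs)
    ... | no _  = trans (∑-filter P? f xs) (sym (+-identityˡ _))

    ∑-when : ∀ {B : Set} (B? : Dec B) (f : A → Carrier) xs → ∑ (λ x → when B? (f x)) xs ≈ when B? (∑ f xs)
    ∑-when (yes _) f xs = refl
    ∑-when (no _)  f xs = ∑-0 xs

    ∑-↭ : ∀ {f : A → Carrier} {xs ys} → xs ↭ ys → ∑ f xs ≈ ∑ f ys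
    ∑-↭ Perm↭.refl = refl
    ∑-↭ (Perm↭.prep x p) = +-congˡ (∑-↭ p)
    ∑-↭ {f} (Perm↭.swap {xs} {ys} x y p) = trans
      (solve 3 (λ a b c → a :+ (b :+ c) := b :+ (a :+ c)) refl (f x) (f y) (∑ f xs))
      (+-congˡ (+-congˡ (∑-↭ p)))
      where open Solver commutativeSemiring
    ∑-↭ (Perm↭.trans p q) = trans (∑-↭ p) (∑-↭ q)

    Πᴸ-power : ∀ {P : A → Set} (P? : Decidable P) x xs
      → x ^ length (filter P? xs) ≈ Πᴸ (map (λ a → opt (P? a) x) xs)
    Πᴸ-power P? x []       = refl
    Πᴸ-power P? x (a ∷ xs) with P? a
    ... | yes _ = *-congˡ (Πᴸ-power P? x xs)
    ... | no _  = trans (Πᴸ-power P? x xs) (sym (*-identityˡ _))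

    Πᴸ-filter : ∀ {P : A → Set} (P? : Decidable P) (f : A → Carrier) xs
      → Πᴸ (map f (filter P? xs)) ≈ Πᴸ (map (λ a → opt (P? a) (f a)) xs)
    Πᴸ-filter P? f []       = refl
    Πᴸ-filter P? f (a ∷ xs) with P? a
    ... | yes _ = *-congˡ (Πᴸ-filter P? f xs)
    ... | no _  = trans (Πᴸ-filter P? f xs) (sym (*-identityˡ _))

    Πᴸ-tabulate : ∀ {n} (f : A → Carrier) (g : Fin n → A) → Πᴸ (map f (L.tabulate g)) ≡ Π.sum (f ∘ g)
    Πᴸ-tabulate {zero}  f g = ≡.refl
    Πᴸ-tabulate {suc n} f g = ≡.cong (f (g zero) *_) (Πᴸ-tabulate f (g ∘ suc))

  ∑-matching : ∀ {A B : Set} (_~_ : A → B → Set)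
    → (∀ {x y y'} → x ~ y → x ~ y' → y ≡ y')
    → (∀ {x x' y} → x ~ y → x' ~ y → x ≡ x')
    → ∀ {xs ys} → Unique xs → Unique ys
    → (∀ {x} → x ∈ xs → ∃ λ y → y ∈ ys × x ~ y)
    → (∀ {y} → y ∈ ys → ∃ λ x → x ∈ xs × x ~ y)
    → ∀ {f g} → (∀ {x y} → x ~ y → f x ≈ g y) → ∑ f xs ≈ ∑ g ys
  ∑-matching _~_ fun inj uxs uys total onto {f} {g} e with matching _~_ fun inj uxs uys total onto
  ... | zs , zs↭ys , pw = trans (termwise pw) (∑-↭ zs↭ys)
    where
    termwise : ∀ {xs zs} → Pointwise _~_ xs zs → ∑ f xs ≈ ∑ g zs
    termwise []       = refl
    termwise (r ∷ rs) = +-cong (e r) (termwise rs)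

  -- Once d and its predecessor m are prescribed, deletion is a bijection. Every case of the
  -- recurrence except the valley passes through this transfer.
  ∑-Del : ∀ {n} {d : Fin (suc n)} (m : Maybe (Fin n))
    {P : Vec (Fin (suc n)) (suc n) → Set} (P? : Decidable P) {Q : Vec (Fin n) n → Set} (Q? : Decidable Q)
    → (∀ {σ} → P σ → Before m d σ)
    → (∀ {σ τ} → Perm σ → Perm τ → Del d σ τ → P σ → Q τ)
    → (∀ {σ τ} → Perm σ → Perm τ → Del d σ τ → Before m d σ → Q τ → P σ)
    → ∀ {f g} → (∀ {σ τ} → Perm σ → Perm τ → Del d σ τ → P σ → f σ ≈ g τ)
    → ∑ f (filter P? (Sym (suc n))) ≈ ∑ g (filter Q? (Sym n))
  ∑-Del {n} {d} m {P} P? {Q} Q? before P⇒Q Q⇒P weights =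
    ∑-matching _~_ (λ (_ , _ , _ , D) (_ , _ , _ , D') → Del-unique D D')
      (λ (p , _ , P₁ , D) (p' , _ , P₂ , D') → Ins-unique {m = m} p p' D D' (before P₁) (before P₂))
      (Uₚ.filter⁺ P? (Sym-unique (suc n))) (Uₚ.filter⁺ Q? (Sym-unique n)) total onto
      (λ (p , q , Pσ , D) → weights p q D Pσ)
    where
    _~_ : Vec (Fin (suc n)) (suc n) → Vec (Fin n) n → Set
    σ ~ τ = Perm σ × Perm τ × P σ × Del d σ τ
    total : ∀ {σ} → σ ∈ filter P? (Sym (suc n)) → ∃ λ τ → τ ∈ filter Q? (Sym n) × σ ~ τ
    total {σ} σ∈ with ∈ₚ.∈-filter⁻ P? {xs = Sym (suc n)} σ∈
    ... | σ∈Sym , Pσ with Del-exists {σ = σ} (∈-Sym⁻ σ∈Sym) d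
    ...   | τ , q , D = τ , ∈ₚ.∈-filter⁺ Q? (∈-Sym⁺ q) (P⇒Q (∈-Sym⁻ σ∈Sym) q D Pσ) , ∈-Sym⁻ σ∈Sym , q , Pσ , D
    onto : ∀ {τ} → τ ∈ filter Q? (Sym n) → ∃ λ σ → σ ∈ filter P? (Sym (suc n)) × σ ~ τ
    onto {τ} τ∈ with ∈ₚ.∈-filter⁻ Q? {xs = Sym n} τ∈
    ... | τ∈Sym , Qτ with Ins-exists {τ = τ} (∈-Sym⁻ τ∈Sym) d m
    ...   | σ , p , D , b = σ , ∈ₚ.∈-filter⁺ P? (∈-Sym⁺ p) (Q⇒P p (∈-Sym⁻ τ∈Sym) D b Qτ) , p , ∈-Sym⁻ τ∈Sym , Q⇒P p (∈-Sym⁻ τ∈Sym) D b Qτ , D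

-- Power series and convergents of the fraction.

module Fraction {c ℓ : Level} (R : CommutativeRing c ℓ) where
  open Ring R hiding (zero)
  open SetoidReasoning setoid
  open Solver commutativeSemiring

  infixl 7 _⊛_
  _⊛_ : Series → Series → Series
  (f ⊛ g) zero    = f 0 * g 0
  (f ⊛ g) (suc n) = f 0 * g (suc n) + ((f ∘ suc) ⊛ g) n

  infixr 8 t·_
  t·_ : Series → Series
  (t· f) zero    = 0#
  (t· f) (suc n) = f n

  infix 4 _≋_
  _≋_ : Series → Series → Set ℓ
  f ≋ g = ∀ n → f n ≈ g n

  ⊛-cong : ∀ {f f' g g'} → f ≋ f' → g ≋ g' → f ⊛ g ≋ f' ⊛ g'
  ⊛-cong p q zero    = *-cong (p 0) (q 0)
  ⊛-cong p q (suc n) = +-cong (*-cong (p 0) (q (suc n))) (⊛-cong (p ∘ suc) q n)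

  -- Two scalars at once serve both the shifted product in associativity and the two-term expansion
  -- of the fraction.
  ⊛-linearˡ : ∀ a b f g h → (λ n → a * f n + b * g n) ⊛ h ≋ λ n → a * (f ⊛ h) n + b * (g ⊛ h) n
  ⊛-linearˡ a b f g h zero = solve 5 (λ a b x y z → (a :* x :+ b :* y) :* z := a :* (x :* z) :+ b :* (y :* z)) refl a b (f 0) (g 0) (h 0)
  ⊛-linearˡ a b f g h (suc n) = trans (+-congˡ (⊛-linearˡ a b (f ∘ suc) (g ∘ suc) h n))
    (solve 7 (λ a b x y z u v → (a :* x :+ b :* y) :* z :+ (a :* u :+ b :* v) := a :* (x :* z :+ u) :+ b :* (y :* z :+ v)) refl
      a b (f 0) (g 0) (h (suc n)) (((f ∘ suc) ⊛ h) n) (((g ∘ suc) ⊛ h) n))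

  ⊛-scaleʳ : ∀ a f g n → (f ⊛ (λ m → a * g m)) n ≈ a * (f ⊛ g) n
  ⊛-scaleʳ a f g zero = solve 3 (λ a x y → x :* (a :* y) := a :* (x :* y)) refl a (f 0) (g 0)
  ⊛-scaleʳ a f g (suc n) = trans (+-congˡ (⊛-scaleʳ a (f ∘ suc) g n))
    (solve 4 (λ a x y z → x :* (a :* y) :+ a :* z := a :* (x :* y :+ z)) refl a (f 0) (g (suc n)) (((f ∘ suc) ⊛ g) n))

  ⊛-assoc : ∀ f g h → (f ⊛ g) ⊛ h ≋ f ⊛ (g ⊛ h)
  ⊛-assoc f g h zero = *-assoc _ _ _
  ⊛-assoc f g h (suc n) = begin
    f 0 * g 0 * h (suc n) + ((λ m → f 0 * g (suc m) + ((f ∘ suc) ⊛ g) m) ⊛ h) n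
      ≈⟨ +-congˡ (⊛-cong {g = h} (λ m → +-congˡ (sym (*-identityˡ _))) (λ _ → refl) n) ⟩
    f 0 * g 0 * h (suc n) + ((λ m → f 0 * g (suc m) + 1# * ((f ∘ suc) ⊛ g) m) ⊛ h) n
      ≈⟨ +-congˡ (⊛-linearˡ (f 0) 1# (g ∘ suc) ((f ∘ suc) ⊛ g) h n) ⟩
    f 0 * g 0 * h (suc n) + (f 0 * ((g ∘ suc) ⊛ h) n + 1# * (((f ∘ suc) ⊛ g) ⊛ h) n)
      ≈⟨ +-congˡ (+-congˡ (trans (*-identityˡ _) (⊛-assoc (f ∘ suc) g h n))) ⟩
    f 0 * g 0 * h (suc n) + (f 0 * ((g ∘ suc) ⊛ h) n + ((f ∘ suc) ⊛ (g ⊛ h)) n)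
      ≈⟨ solve 5 (λ x y z u v → x :* y :* z :+ (x :* u :+ v) := x :* (y :* z :+ u) :+ v) refl
           (f 0) (g 0) (h (suc n)) (((g ∘ suc) ⊛ h) n) (((f ∘ suc) ⊛ (g ⊛ h)) n) ⟩
    f 0 * (g ⊛ h) (suc n) + ((f ∘ suc) ⊛ (g ⊛ h)) n ∎

  t·-⊛ʳ : ∀ f g → f ⊛ t· g ≋ t· (f ⊛ g)
  t·-⊛ʳ f g zero = zeroʳ _
  t·-⊛ʳ f g (suc zero) = trans (+-congˡ (zeroʳ _)) (+-identityʳ _)
  t·-⊛ʳ f g (suc (suc n)) = +-congˡ (t·-⊛ʳ (f ∘ suc) g (suc n))

  t·-⊛ˡ : ∀ f g → t· f ⊛ g ≋ t· (f ⊛ g)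
  t·-⊛ˡ f g zero = zeroˡ _
  t·-⊛ˡ f g (suc n) = trans (+-congʳ (zeroˡ _)) (+-identityˡ _)

  -- `geomRev` lists coefficients downwards, so pairing it with g 0, g 1, ... already is a Cauchy
  -- product. In `convolve` the left factor is arbitrary because the recursion shifts it and leaves
  -- `geom g` alone.
  geom-suc : ∀ g m → geom g (suc m) ≈ (g ⊛ geom g) m
  geom-suc g m = trans (reflexive (≡.cong (λ xs → Σᴸ (zipWith _*_ xs (geomRev g m))) (Lₚ.map-applyUpTo id g (suc m)))) (convolve g m)
    where
    convolve : ∀ f m → Σᴸ (zipWith _*_ (applyUpTo f (suc m)) (geomRev g m)) ≈ (f ⊛ geom g) m
    convolve f zero    = +-identityʳ _
    convolve f (suc m) = +-congˡ (convolve (f ∘ suc) m)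

  -- G N h counts weighted Motzkin paths of N steps between heights h and 0. With
  -- J h the fraction started at level h, decomposing such a path at its first
  -- passage below h gives G _ (suc h) = t b_h J (suc h) ⊛ G _ h; this series K,
  -- built from truncations of the fraction, is shown to satisfy the recurrence of G.
  module _ (γ β b : ℕ → Carrier) (y : Carrier) (β≈ : ∀ m → β (suc m) ≈ b m * y)
           (G : ℕ → ℕ → Carrier)
           (G-00 : G 0 0 ≈ 1#) (G-0s : ∀ h → G 0 (suc h) ≈ 0#)
           (G-s0 : ∀ N → G (suc N) 0 ≈ γ 0 * G N 0 + y * G N 1)
           (G-ss : ∀ N h → G (suc N) (suc h) ≈ γ (suc h) * G N (suc h) + y * G N (suc (suc h)) + b h * G N h)
           (k : ℕ) where

    J : ℕ → Series
    J h = conv γ β (k ∸ h) h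

    J-zero : ∀ h → J h 0 ≈ 1#
    J-zero h with k ∸ h
    ... | zero  = refl
    ... | suc _ = refl

    J-suc : ∀ h → h < k → ∀ N → J h (suc N) ≈ γ h * J h N + β (suc h) * (t· (J (suc h) ⊛ J h)) N
    -- The depth k - h is rewritten as a successor, which h < k permits, so that one level of `conv`
    -- unfolds.
    J-suc h h<k N = ≡.subst (λ d → conv γ β d h (suc N) ≈ γ h * conv γ β d h N + β (suc h) * (t· (J (suc h) ⊛ conv γ β d h)) N)
      (≡.trans (≡.sym (ℕₚ.+-∸-assoc 1 h<k)) ≡.refl) (expand N)
      where
      X = conv γ β (suc (k ∸ suc h)) h
      expand : ∀ N → X (suc N) ≈ γ h * X N + β (suc h) * (t· (J (suc h) ⊛ X)) N
      expand zero = +-congˡ (sym (zeroʳ _))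
      expand (suc M) = trans (geom-suc _ (suc M)) (+-congˡ (scale (J (suc h)) M))
        where
        scale : ∀ f M → ((λ m → β (suc h) * f m) ⊛ X) M ≈ β (suc h) * (f ⊛ X) M
        scale f zero = *-assoc _ _ _
        scale f (suc M) = trans (+-cong (*-assoc _ _ _) (scale (f ∘ suc) M)) (sym (distribˡ _ _ _))

    K : ℕ → Series
    K zero    = J 0
    K (suc h) = t· (λ n → b h * (J (suc h) ⊛ K h) n)

    K-s0 : 0 < k → ∀ N → K 0 (suc N) ≈ γ 0 * K 0 N + y * K 1 N
    K-s0 0<k N = trans (J-suc 0 0<k N) (+-congˡ (last N))
      where
      last : ∀ N → β 1 * (t· (J 1 ⊛ J 0)) N ≈ y * K 1 N
      last zero = trans (zeroʳ _) (sym (zeroʳ _))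
      last (suc N) = trans (*-congʳ (β≈ 0)) (solve 3 (λ b y z → b :* y :* z := y :* (b :* z)) refl (b 0) y _)

    -- Expand J (h + 1) inside K (h + 1). Its constant term 1 gives the step down and γ the level
    -- step. In the last term β splits as b y: y is the step up, and the remaining b completes K (h
    -- + 2) once the factor t has been moved next to J (h + 1) ⊛ K h.
    K-ss : ∀ h → suc h < k → ∀ N → K (suc h) (suc N) ≈ γ (suc h) * K (suc h) N + y * K (suc (suc h)) N + b h * K h N
    K-ss h h<k zero = begin
      b h * (J (suc h) 0 * K h 0)  ≈⟨ *-congˡ (trans (*-congʳ (J-zero (suc h))) (*-identityˡ _)) ⟩
      b h * K h 0                  ≈⟨ solve 3 (λ g y z → z := g :* con 0 :+ y :* con 0 :+ z) refl (γ (suc h)) y (b h * K h 0) ⟩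
      γ (suc h) * 0# + y * 0# + b h * K h 0 ∎
    K-ss h h<k (suc M) = begin
      b h * (J₁ 0 * K h (suc M) + ((J₁ ∘ suc) ⊛ K h) M)
        ≈⟨ *-congˡ (+-cong (trans (*-congʳ (J-zero (suc h))) (*-identityˡ _))
             (trans (⊛-cong {g = K h} (J-suc (suc h) h<k) (λ _ → refl) M)
                    (⊛-linearˡ (γ (suc h)) (β (suc (suc h))) J₁ (t· (J₂ ⊛ J₁)) (K h) M))) ⟩
      b h * (K h (suc M) + (γ (suc h) * (J₁ ⊛ K h) M + β (suc (suc h)) * (t· (J₂ ⊛ J₁) ⊛ K h) M))
        ≈⟨ *-congˡ (+-congˡ (+-congˡ (*-cong (β≈ (suc h)) rotate))) ⟩
      b h * (K h (suc M) + (γ (suc h) * (J₁ ⊛ K h) M + b (suc h) * y * (J₂ ⊛ t· (J₁ ⊛ K h)) M))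
        ≈⟨ solve 7 (λ b y g b' u v w → b :* (u :+ (g :* v :+ b' :* y :* w)) := g :* (b :* v) :+ y :* (b' :* (b :* w)) :+ b :* u) refl
             (b h) y (γ (suc h)) (b (suc h)) (K h (suc M)) ((J₁ ⊛ K h) M) ((J₂ ⊛ t· (J₁ ⊛ K h)) M) ⟩
      γ (suc h) * (b h * (J₁ ⊛ K h) M) + y * (b (suc h) * (b h * (J₂ ⊛ t· (J₁ ⊛ K h)) M)) + b h * K h (suc M)
        ≈⟨ +-congʳ (+-congˡ (*-congˡ (*-congˡ (trans (sym (⊛-scaleʳ (b h) J₂ (t· (J₁ ⊛ K h)) M)) (⊛-cong {f = J₂} (λ _ → refl) pull M))))) ⟩
      γ (suc h) * (b h * (J₁ ⊛ K h) M) + y * (b (suc h) * (J₂ ⊛ K (suc h)) M) + b h * K h (suc M) ∎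
      where
      J₁ = J (suc h)
      J₂ = J (suc (suc h))
      pull : (λ m → b h * (t· (J₁ ⊛ K h)) m) ≋ K (suc h)
      pull zero    = zeroʳ _
      pull (suc m) = refl
      rotate : (t· (J₂ ⊛ J₁) ⊛ K h) M ≈ (J₂ ⊛ t· (J₁ ⊛ K h)) M
      rotate = trans (t·-⊛ˡ (J₂ ⊛ J₁) (K h) M) (trans (under M) (sym (t·-⊛ʳ J₂ (J₁ ⊛ K h) M)))
        where
        under : t· ((J₂ ⊛ J₁) ⊛ K h) ≋ t· (J₂ ⊛ (J₁ ⊛ K h))
        under zero    = refl
        under (suc n) = ⊛-assoc J₂ J₁ (K h) n

    -- The bound survives the recurrence: a step up trades one unit of N for one of h, and the other
    -- steps lower h + N. So every fraction that gets expanded starts below level k, where the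
    -- truncation is not yet felt.
    K≈G : ∀ N h → h ℕ.+ N ≤ k → K h N ≈ G N h
    K≈G zero    zero    _ = trans (J-zero 0) (sym G-00)
    K≈G zero    (suc h) _ = sym (G-0s h)
    K≈G (suc N) zero    N<k = trans (K-s0 (ℕₚ.≤-trans (s≤s z≤n) N<k) N)
      (trans (+-cong (*-congˡ (K≈G N 0 (ℕₚ.<⇒≤ N<k))) (*-congˡ (K≈G N 1 N<k))) (sym (G-s0 N)))
    K≈G (suc N) (suc h) le = trans (K-ss h (ℕₚ.≤-trans (s≤s (ℕₚ.m≤m+n (suc h) N)) le') N)
      (trans (+-cong (+-cong (*-congˡ (K≈G N (suc h) (ℕₚ.<⇒≤ le'))) (*-congˡ (K≈G N (suc (suc h)) le')))
               (*-congˡ (K≈G N h (ℕₚ.≤-trans (ℕₚ.n≤1+n _) (ℕₚ.<⇒≤ le')))))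
             (sym (G-ss N h)))
      where
      le' : suc (suc h ℕ.+ N) ≤ k
      le' = ≡.subst (_≤ k) (ℕₚ.+-suc (suc h) N) le

    conv≈G : ∀ n → n ≤ k → conv γ β k 0 n ≈ G n 0
    conv≈G n n≤k = K≈G n 0 n≤k

-- Local factors and the weight of a state.

module Weights {c ℓ : Level} (R : CommutativeRing c ℓ)
  (x₁ x₂ y₁ y₂ u₁ u₂ v₂ : CommutativeRing.Carrier R) (w : ℕ → CommutativeRing.Carrier R) (lam : CommutativeRing.Carrier R) where
  open Ring R hiding (zero)
  open Sums R

  value : Label → Carrier
  value (fixᴸ k)  = w k
  value (peakᴸ b) = if b then x₁ else u₁
  value (fallᴸ b) = if b then x₂ else u₂
  value (riseᴸ b) = if b then y₂ else v₂
  value valleyᴸ   = y₁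

  module _ {n} (σ : Vec (Fin n) n) where

    -- All exponents of `Qhat`, at v₁ = y₁, read at one index; as a product over indices the weight
    -- can be cut off at h. Cycles are the one statistic that is not local.
    loc : Fin n → Carrier
    loc i = opt (earec? σ i ×-dec cpeak? σ i) x₁ * opt (earec? σ i ×-dec cdfall? σ i) x₂
          * opt (erec? σ i ×-dec cvalley? σ i) y₁ * opt (erec? σ i ×-dec cdrise? σ i) y₂
          * opt (nr? σ i ×-dec cpeak? σ i) u₁ * opt (nr? σ i ×-dec cdfall? σ i) u₂
          * opt (nr? σ i ×-dec cvalley? σ i) y₁ * opt (nr? σ i ×-dec cdrise? σ i) v₂
          * opt (fixed? σ i) (w (psnest σ i))

    -- The cycle count is not cut off: in a state every index below h escapes, so every cycle
    -- contains an index at or above h.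
    W : ℕ → Carrier
    W h = Π.sum (λ i → opt (h ℕₚ.≤? toℕ i) (loc i)) * lam ^ cyc σ

  pair-none : ∀ {E N P : Set} (E? : Dec E) (N? : Dec N) (P? : Dec P) {x u} → ¬ P
    → opt (E? ×-dec P?) x * opt (N? ×-dec P?) u ≈ 1#
  pair-none E? N? P? ¬p = trans (*-cong (opt-no (E? ×-dec P?) (¬p ∘ proj₂)) (opt-no (N? ×-dec P?) (¬p ∘ proj₂))) (*-identityˡ 1#)

  pair-some : ∀ {B C P : Set} (B? : Dec B) (C? : Dec C) (P? : Dec P) {x u b} → P → ¬ C → Reflects B b
    → opt ((B? ×-dec ¬? C?) ×-dec P?) x * opt ((¬? B? ×-dec ¬? C?) ×-dec P?) u ≈ (if b then x else u)
  pair-some B? C? P? p ¬c (ofʸ b) = trans (*-cong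
    (opt-yes ((B? ×-dec ¬? C?) ×-dec P?) ((b , ¬c) , p))
    (opt-no ((¬? B? ×-dec ¬? C?) ×-dec P?) (λ ((¬b , _) , _) → ¬b b))) (*-identityʳ _)
  pair-some B? C? P? p ¬c (ofⁿ ¬b) = trans (*-cong
    (opt-no ((B? ×-dec ¬? C?) ×-dec P?) (λ ((b , _) , _) → ¬b b))
    (opt-yes ((¬? B? ×-dec ¬? C?) ×-dec P?) ((¬b , ¬c) , p))) (*-identityˡ _)

  -- `NR` tests the record first, while `pair-some` expects the test of the exclusive class first,
  -- which for peaks and falls is the antirecord.
  opt-×-comm : ∀ {A B P : Set} (A? : Dec A) (B? : Dec B) (P? : Dec P) {x}
    → opt ((A? ×-dec B?) ×-dec P?) x ≈ opt ((B? ×-dec A?) ×-dec P?) x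
  opt-×-comm (yes _) (yes _) (yes _) = refl
  opt-×-comm (yes _) (yes _) (no _)  = refl
  opt-×-comm (yes _) (no _)  (yes _) = refl
  opt-×-comm (yes _) (no _)  (no _)  = refl
  opt-×-comm (no _)  (yes _) (yes _) = refl
  opt-×-comm (no _)  (yes _) (no _)  = refl
  opt-×-comm (no _)  (no _)  (yes _) = refl
  opt-×-comm (no _)  (no _)  (no _)  = refl

  module _ {n} {σ : Vec (Fin n) n} (σ-perm : Perm σ) (i : Fin n) where
    private
      P = opt (earec? σ i ×-dec cpeak? σ i) x₁ * opt (nr? σ i ×-dec cpeak? σ i) u₁
      L = opt (earec? σ i ×-dec cdfall? σ i) x₂ * opt (nr? σ i ×-dec cdfall? σ i) u₂
      U = opt (erec? σ i ×-dec cvalley? σ i) y₁ * opt (nr? σ i ×-dec cvalley? σ i) y₁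
      D = opt (erec? σ i ×-dec cdrise? σ i) y₂ * opt (nr? σ i ×-dec cdrise? σ i) v₂
      X = opt (fixed? σ i) (w (psnest σ i))

      regroup : loc σ i ≈ P * L * U * D * X
      regroup = solve 9 (λ a b c d e f g h x → a :* b :* c :* d :* e :* f :* g :* h :* x
          := (a :* e) :* (b :* f) :* (c :* g) :* (d :* h) :* x) refl
        (opt (earec? σ i ×-dec cpeak? σ i) x₁) (opt (earec? σ i ×-dec cdfall? σ i) x₂)
        (opt (erec? σ i ×-dec cvalley? σ i) y₁) (opt (erec? σ i ×-dec cdrise? σ i) y₂)
        (opt (nr? σ i ×-dec cpeak? σ i) u₁) (opt (nr? σ i ×-dec cdfall? σ i) u₂)
        (opt (nr? σ i ×-dec cvalley? σ i) y₁) (opt (nr? σ i ×-dec cdrise? σ i) v₂)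
        (opt (fixed? σ i) (w (psnest σ i)))
        where open Solver commutativeSemiring

      assemble : ∀ {a b c d e} → P ≈ a → L ≈ b → U ≈ c → D ≈ d → X ≈ e → loc σ i ≈ a * b * c * d * e
      assemble p l u d x = trans regroup (*-cong (*-cong (*-cong (*-cong p l) u) d) x)

      inv-is : ∀ {p} → lookup σ p ≡ i → inv σ i ≡ p
      inv-is e = σ-perm _ _ (≡.trans (inv-inverse {σ = σ} σ-perm i) (≡.sym e))

      ¬P = λ ¬p → pair-none (earec? σ i) (nr? σ i) (cpeak? σ i) {x₁} {u₁} ¬p
      ¬L = λ ¬p → pair-none (earec? σ i) (nr? σ i) (cdfall? σ i) {x₂} {u₂} ¬p
      ¬U = λ ¬p → pair-none (erec? σ i) (nr? σ i) (cvalley? σ i) {y₁} {y₁} ¬p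
      ¬D = λ ¬p → pair-none (erec? σ i) (nr? σ i) (cdrise? σ i) {y₂} {v₂} ¬p
      ¬X : ¬ Fixed σ i → X ≈ 1#
      ¬X ¬f = opt-no (fixed? σ i) ¬f

      nr-comm : ∀ {Q : Set} (Q? : Dec Q) {x}
        → opt (nr? σ i ×-dec Q?) x ≈ opt ((¬? (antirecord? σ i) ×-dec ¬? (record? σ i)) ×-dec Q?) x
      nr-comm Q? = opt-×-comm (¬? (record? σ i)) (¬? (antirecord? σ i)) Q?

      fall-not : lookup σ i F.< i → ¬ Fixed σ i
      fall-not lt e = ℕₚ.<⇒≢ lt (≡.cong toℕ e)
      rise-not : i F.< lookup σ i → ¬ Fixed σ i
      rise-not lt e = ℕₚ.<⇒≢ lt (≡.cong toℕ (≡.sym e))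

    open Solver commutativeSemiring

    loc-value : ∀ {l} → HasLabel σ i l → loc σ i ≈ value l
    loc-value (fix e) = trans
      (assemble (¬P λ (_ , lt) → fall-not lt e) (¬L λ (_ , lt) → fall-not lt e)
                (¬U λ (_ , lt) → rise-not lt e) (¬D λ (_ , lt) → rise-not lt e) (opt-yes (fixed? σ i) e))
      (solve 1 (λ x → con 1 :* con 1 :* con 1 :* con 1 :* x := x) refl _)
    loc-value (peak e p<i lt r) with inv-is e
    ... | ≡.refl = trans
      (assemble (trans (*-congˡ (nr-comm (cpeak? σ i)))
                  (pair-some (antirecord? σ i) (record? σ i) (cpeak? σ i) (p<i , lt) (fall⇒¬record {σ = σ} σ-perm lt) r))
                (¬L λ (gt , _) → ℕₚ.<-asym p<i gt)
                (¬U λ (_ , gt) → ℕₚ.<-asym lt gt) (¬D λ (_ , gt) → ℕₚ.<-asym lt gt) (¬X (fall-not lt)))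
      (solve 1 (λ x → x :* con 1 :* con 1 :* con 1 :* con 1 := x) refl _)
    loc-value (fall e i<p lt r) with inv-is e
    ... | ≡.refl = trans
      (assemble (¬P λ (gt , _) → ℕₚ.<-asym i<p gt)
                (trans (*-congˡ (nr-comm (cdfall? σ i)))
                  (pair-some (antirecord? σ i) (record? σ i) (cdfall? σ i) (i<p , lt) (fall⇒¬record {σ = σ} σ-perm lt) r))
                (¬U λ (_ , gt) → ℕₚ.<-asym lt gt) (¬D λ (_ , gt) → ℕₚ.<-asym lt gt) (¬X (fall-not lt)))
      (solve 1 (λ x → con 1 :* x :* con 1 :* con 1 :* con 1 := x) refl _)
    loc-value (valley e i<p gt) with inv-is e
    ... | ≡.refl = trans
      (assemble (¬P λ (_ , lt) → ℕₚ.<-asym lt gt) (¬L λ (_ , lt) → ℕₚ.<-asym lt gt)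
                (trans (pair-some (record? σ i) (antirecord? σ i) (cvalley? σ i) (i<p , gt)
                  (exceedance⇒¬antirecord {σ = σ} σ-perm gt) (reflected (record? σ i))) (either (Dec.does (record? σ i))))
                (¬D λ (lt , _) → ℕₚ.<-asym lt i<p) (¬X (rise-not gt)))
      (solve 1 (λ x → con 1 :* con 1 :* x :* con 1 :* con 1 := x) refl _)
      where
      -- Record or not, a valley carries y₁; this is where v₁ = y₁ enters.
      either : ∀ b → (if b then y₁ else y₁) ≈ y₁
      either true  = refl
      either false = refl
    loc-value (rise e p<i gt r) with inv-is e
    ... | ≡.refl = trans
      (assemble (¬P λ (_ , lt) → ℕₚ.<-asym lt gt) (¬L λ (_ , lt) → ℕₚ.<-asym lt gt)
                (¬U λ (lt , _) → ℕₚ.<-asym lt p<i)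
                (pair-some (record? σ i) (antirecord? σ i) (cdrise? σ i) (p<i , gt)
                  (exceedance⇒¬antirecord {σ = σ} σ-perm gt) r)
                (¬X (rise-not gt)))
      (solve 1 (λ x → con 1 :* con 1 :* con 1 :* x :* con 1 := x) refl _)

  W-step : ∀ {n} (σ : Vec (Fin (suc n)) (suc n)) H → W σ (toℕ H) ≈ loc σ H * W σ (suc (toℕ H))
  W-step {n} σ H = trans (*-congʳ (trans (Π.sum-remove {i = H} (from (toℕ H)))
      (*-cong (opt-yes (toℕ H ℕₚ.≤? toℕ H) ℕₚ.≤-refl)
        (trans (Π.sum-cong-≋ {n} others) (trans (sym (*-identityˡ _))
          (trans (*-congʳ (sym (opt-no (suc (toℕ H) ℕₚ.≤? toℕ H) (ℕₚ.<-irrefl ≡.refl))))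
            (sym (Π.sum-remove {i = H} (from (suc (toℕ H)))))))))))
    (*-assoc _ _ _)
    where
    from : ℕ → Fin (suc n) → Carrier
    from h i = opt (h ℕₚ.≤? toℕ i) (loc σ i)
    others : ∀ j → from (toℕ H) (punchIn H j) ≈ from (suc (toℕ H)) (punchIn H j)
    others j with ℕₚ.<-cmp (toℕ H) (toℕ (punchIn H j))
    ... | tri< lt _ _ = trans (opt-yes (toℕ H ℕₚ.≤? _) (ℕₚ.<⇒≤ lt)) (sym (opt-yes (suc (toℕ H) ℕₚ.≤? _) lt))
    ... | tri≈ _ e _ = ⊥-elim (Fₚ.punchInᵢ≢i H j (≡.sym (Fₚ.toℕ-injective e)))
    ... | tri> ¬lt _ gt = trans (opt-no (toℕ H ℕₚ.≤? _) (ℕₚ.<⇒≱ gt)) (sym (opt-no (suc (toℕ H) ℕₚ.≤? _) ¬lt))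

  module _ {n} {d : Fin (suc n)} {σ : Vec (Fin (suc n)) (suc n)} {τ : Vec (Fin n) n}
           (σ-perm : Perm σ) (τ-perm : Perm τ) (del : Del d σ τ)
           (h : ℕ) (d≤h : toℕ d ≤ h) (pre : ∀ p → lookup σ p ≡ d → toℕ p ≤ h) where

    -- Since d ≤ h, deletion shifts the cut-off from h + 1 to h. At each surviving index both
    -- factors equal the value of one common label, which `Above` carries over.
    product-Del : Π.sum (λ i → opt (suc h ℕₚ.≤? toℕ i) (loc σ i)) ≈ Π.sum (λ j → opt (h ℕₚ.≤? toℕ j) (loc τ j))
    product-Del = trans (Π.sum-remove {i = d} (λ i → opt (suc h ℕₚ.≤? toℕ i) (loc σ i)))
      (trans (*-cong (opt-no (suc h ℕₚ.≤? toℕ d) (ℕₚ.≤⇒≯ d≤h)) (Π.sum-cong-≋ {n} term)) (*-identityˡ _))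
      where
      term : ∀ j → opt (suc h ℕₚ.≤? toℕ (punchIn d j)) (loc σ (punchIn d j)) ≈ opt (h ℕₚ.≤? toℕ j) (loc τ j)
      term j with h ℕₚ.≤? toℕ j
      ... | no h≰j = opt-no (suc h ℕₚ.≤? _) λ le → h≰j (ℕ.s≤s⁻¹ (ℕₚ.≤-trans le (punchIn-≤-suc d j)))
      ... | yes h≤j = trans (opt-yes (suc h ℕₚ.≤? _) (≡.subst (suc h ≤_) (≡.sym ψj) (s≤s h≤j))) (labelled (hasLabel {σ = σ} σ-perm (punchIn d j)))
        where
        ψj : toℕ (punchIn d j) ≡ suc (toℕ j)
        ψj = toℕ-punchIn-≥ (ℕₚ.≤-trans d≤h h≤j)
        labelled : ∃ (HasLabel σ (punchIn d j)) → loc σ (punchIn d j) ≈ loc τ j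
        labelled (l , has) = trans (loc-value {σ = σ} σ-perm _ has) (sym (loc-value {σ = τ} τ-perm j
          (Above.HasLabel-Del σ-perm τ-perm del j (ℕₚ.≤-trans d≤h h≤j)
            (λ p e → ≡.subst (toℕ p <_) (≡.sym ψj) (s≤s (ℕₚ.≤-trans (pre p e) h≤j))) has)))

    W-Del-moved : lookup σ d ≢ d → W σ (suc h) ≈ W τ h
    W-Del-moved ≢d = *-cong product-Del (reflexive (≡.cong (lam ^_) (cyc-Del-moved σ-perm τ-perm del ≢d)))

    W-Del-fixed : lookup σ d ≡ d → W σ (suc h) ≈ lam * W τ h
    W-Del-fixed ≡d = trans (*-cong product-Del (reflexive (≡.cong (lam ^_) (cyc-Del-fixed σ-perm τ-perm del ≡d))))
      (solve 3 (λ p l x → p :* (l :* x) := l :* (p :* x)) refl _ lam (lam ^ cyc τ))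
      where open Solver commutativeSemiring

  T : ℕ → ℕ → Carrier
  T n h = ∑ (λ σ → W σ h) (filter (escapes? h) (Sym n))

  -- No step is left at positive height: the entry at position 0 would have to lie outside the
  -- range.
  T-diagonal : ∀ h → T (suc h) (suc h) ≈ 0#
  T-diagonal h = trans (∑-filter (escapes? (suc h)) _ (Sym (suc h)))
    (trans (∑-cong (Sym (suc h)) (λ {σ} _ → when-no (escapes? (suc h) σ)
      (λ e → ℕₚ.<⇒≱ (Fₚ.toℕ<n (lookup σ zero)) (e zero z<s)))) (∑-0 (Sym (suc h))))

  T-00 : T 0 0 ≈ 1#
  T-00 = trans (+-identityʳ _) (*-identityˡ 1#)

  Qhat≈T : ∀ n → Qhat n x₁ x₂ y₁ y₂ u₁ u₂ y₁ v₂ w lam ≈ T n 0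
  Qhat≈T n = trans (∑-cong (Sym n) (λ {σ} _ → trans (weight σ) (sym (when-yes (escapes? 0 σ) (λ _ ())))))
    (sym (∑-filter (escapes? 0) (λ σ → W σ 0) (Sym n)))
    where
    module _ (σ : Vec (Fin n) n) where
      power : ∀ {P : Fin n → Set} (P? : Decidable P) x → x ^ countFin σ P? ≈ Π.sum (λ i → opt (P? i) x)
      power P? x = trans (Πᴸ-power P? x (allFin n)) (reflexive (Πᴸ-tabulate (λ i → opt (P? i) x) id))
      fixes : Πᴸ (map (λ i → w (psnest σ i)) (fixList σ)) ≈ Π.sum (λ i → opt (fixed? σ i) (w (psnest σ i)))
      fixes = trans (Πᴸ-filter (fixed? σ) (λ i → w (psnest σ i)) (allFin n)) (reflexive (Πᴸ-tabulate (λ i → opt (fixed? σ i) (w (psnest σ i))) id))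
      infixl 7 _⊗_
      _⊗_ : ∀ {a b} {f g : Fin n → Carrier} → a ≈ Π.sum f → b ≈ Π.sum g → a * b ≈ Π.sum (λ i → f i * g i)
      _⊗_ {f = f} {g} p q = trans (*-cong p q) (sym (Π.∑-distrib-+ f g))
      weight : _ ≈ W σ 0
      weight = *-congʳ (trans
        (power (λ i → earec? σ i ×-dec cpeak? σ i) x₁ ⊗ power (λ i → earec? σ i ×-dec cdfall? σ i) x₂
          ⊗ power (λ i → erec? σ i ×-dec cvalley? σ i) y₁ ⊗ power (λ i → erec? σ i ×-dec cdrise? σ i) y₂
          ⊗ power (λ i → nr? σ i ×-dec cpeak? σ i) u₁ ⊗ power (λ i → nr? σ i ×-dec cdfall? σ i) u₂
          ⊗ power (λ i → nr? σ i ×-dec cvalley? σ i) y₁ ⊗ power (λ i → nr? σ i ×-dec cdrise? σ i) v₂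
          ⊗ fixes)
        (Π.sum-cong-≋ {n} (λ i → sym (opt-yes (0 ℕₚ.≤? toℕ i) z≤n))))

-- The three-term recurrence.

module Recurrence {c ℓ : Level} (R : CommutativeRing c ℓ)
  (x₁ x₂ y₁ y₂ u₁ u₂ v₂ : CommutativeRing.Carrier R) (w : ℕ → CommutativeRing.Carrier R) (lam : CommutativeRing.Carrier R) where
  open Ring R hiding (zero)
  open Sums R
  open Weights R x₁ x₂ y₁ y₂ u₁ u₂ v₂ w lam
  open SetoidReasoning setoid
  open CMSum +-commutativeMonoid using (sum; sum-cong-≋; ∑-distrib-+)

  rising-sum : ∀ {n} → Fin (suc n) → (Vec (Fin (suc n)) (suc n) → Carrier) → Fin n → Carrier
  rising-sum {n} H f q = when (toℕ q ℕₚ.<? toℕ H) (∑ f (filter (rising? H q) (Sym (suc n))))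

  -- The identity holds for each σ separately: the cases exclude each other, and at most one q
  -- contributes because H has a single preimage.
  nonFall-split : ∀ {n} (H : Fin (suc n)) (f : Vec (Fin (suc n)) (suc n) → Carrier)
    → ∑ f (filter (nonFall? H) (Sym (suc n)))
      ≈ ∑ f (filter (escapes? (suc (toℕ H))) (Sym (suc n))) + ∑ f (filter (fixing? H) (Sym (suc n))) + sum (rising-sum H f)
  nonFall-split {n} H f = begin
    ∑ f (filter (nonFall? H) S)                                 ≈⟨ ∑-filter (nonFall? H) f S ⟩
    ∑ (λ σ → when (nonFall? H σ) (f σ)) S                       ≈⟨ ∑-cong S (λ σ∈ → pointwise _ (∈-Sym⁻ σ∈)) ⟩
    ∑ (λ σ → v σ + x σ + sum (r σ)) S                           ≈⟨ ∑-+ S ⟩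
    ∑ (λ σ → v σ + x σ) S + ∑ (λ σ → sum (r σ)) S
      ≈⟨ +-cong (trans (∑-+ S) (+-cong (sym (∑-filter (escapes? (suc (toℕ H))) f S)) (sym (∑-filter (fixing? H) f S))))
                (trans (∑-sum r S) (sum-cong-≋ {n} (λ q → trans (∑-when (toℕ q ℕₚ.<? toℕ H) _ S)
                  (when-cong (toℕ q ℕₚ.<? toℕ H) (λ _ → sym (∑-filter (rising? H q) f S)))))) ⟩
    ∑ f (filter (escapes? (suc (toℕ H))) S) + ∑ f (filter (fixing? H) S) + sum (rising-sum H f) ∎
    where
    S = Sym (suc n)
    v x : Vec (Fin (suc n)) (suc n) → Carrier
    v σ = when (escapes? (suc (toℕ H)) σ) (f σ)
    x σ = when (fixing? H σ) (f σ)
    r : Vec (Fin (suc n)) (suc n) → Fin n → Carrier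
    r σ q = when (toℕ q ℕₚ.<? toℕ H) (when (rising? H q σ) (f σ))

    module _ (σ : Vec (Fin (suc n)) (suc n)) where
      v-no : ¬ Escapes (suc (toℕ H)) σ → v σ ≈ 0#
      v-no = when-no (escapes? (suc (toℕ H)) σ)
      x-no : ¬ Fixing H σ → x σ ≈ 0#
      x-no = when-no (fixing? H σ)
      r-no : ∀ q → ¬ (toℕ q < toℕ H × Rising H q σ) → r σ q ≈ 0#
      r-no q ¬r with toℕ q ℕₚ.<? toℕ H
      ... | no _ = refl
      ... | yes lt = when-no (rising? H q σ) (λ r → ¬r (lt , r))
      exceeds-not : H F.< lookup σ H → ¬ Fixing H σ
      exceeds-not lt (_ , e) = ℕₚ.<⇒≢ lt (≡.cong toℕ (≡.sym e))
      rises-not : ∀ {q} → toℕ q < toℕ H → lookup σ (punchIn H q) ≡ H → ¬ Escapes (suc (toℕ H)) σ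
      rises-not {q} q<H e esc = ℕₚ.<⇒≢ (esc (punchIn H q) (≡.subst (_< suc (toℕ H)) (≡.sym (toℕ-punchIn-< q<H)) (ℕₚ.m<n⇒m<1+n q<H)))
        (≡.sym (≡.cong toℕ e))

      pointwise : Perm σ → when (nonFall? H σ) (f σ) ≈ v σ + x σ + sum (r σ)
      pointwise σ-perm with nonFall? H σ
      ... | no ¬nf = sym (trans (+-cong (trans (+-cong
              (v-no λ e → ¬nf (proj₁ (escapes-suc⁻ H {σ} e) , ℕₚ.<⇒≤ (proj₂ (escapes-suc⁻ H {σ} e))))
              (x-no λ (e , fx) → ¬nf (e , ℕₚ.≤-reflexive (≡.cong toℕ (≡.sym fx))))) (+-identityʳ 0#))
              (sum-zero (r σ) λ q → r-no q λ (_ , e , _ , gt) → ¬nf (e , ℕₚ.<⇒≤ gt))) (+-identityʳ 0#))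
      ... | yes nf@(esc , _) with nonFallCase H {σ} σ-perm nf
      ...   | isValley e = sym (trans (+-cong (trans (+-cong (when-yes (escapes? (suc (toℕ H)) σ) e)
              (x-no (exceeds-not (proj₂ (escapes-suc⁻ H {σ} e))))) (+-identityʳ _))
              (sum-zero (r σ) λ q → r-no q λ (lt , _ , e' , _) → rises-not lt e' e)) (+-identityʳ _))
      ...   | isFixed fx = sym (trans (+-cong (trans (+-cong
              (v-no λ e → exceeds-not (proj₂ (escapes-suc⁻ H {σ} e)) (esc , fx)) (when-yes (fixing? H σ) (esc , fx))) (+-identityˡ _))
              (sum-zero (r σ) λ q → r-no q λ (_ , _ , _ , gt) → exceeds-not gt (esc , fx))) (+-identityʳ _))
      ...   | isRise q q<H e gt = sym (trans (+-cong (trans (+-cong (v-no (rises-not q<H e)) (x-no (exceeds-not gt))) (+-identityʳ 0#))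
              (sum-single (r σ) q (trans (when-yes (toℕ q ℕₚ.<? toℕ H) q<H) (when-yes (rising? H q σ) (esc , e , gt)))
                λ j j≢q → r-no j λ (_ , _ , e' , _) → j≢q (Fₚ.punchIn-injective H j q (σ-perm _ _ (≡.trans e' (≡.sym e))))))
              (+-identityˡ _))

  falling-sum : ∀ {n} → Fin (suc n) → (Vec (Fin (suc n)) (suc n) → Carrier) → Fin (suc n) → Carrier
  falling-sum {n} H f r = when (toℕ r ℕₚ.<? toℕ H) (∑ f (filter (falling? H r) (Sym (suc n))))

  escapes-split : ∀ {n} (H : Fin (suc n)) (f : Vec (Fin (suc n)) (suc n) → Carrier)
    → ∑ f (filter (escapes? (toℕ H)) (Sym (suc n))) ≈ ∑ f (filter (nonFall? H) (Sym (suc n))) + sum (falling-sum H f)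
  escapes-split {n} H f = begin
    ∑ f (filter (escapes? (toℕ H)) S)            ≈⟨ ∑-filter (escapes? (toℕ H)) f S ⟩
    ∑ (λ σ → when (escapes? (toℕ H) σ) (f σ)) S  ≈⟨ ∑-cong S (λ {σ} _ → pointwise σ (escapes? (toℕ H) σ)) ⟩
    ∑ (λ σ → a σ + sum (r σ)) S                  ≈⟨ ∑-+ S ⟩
    ∑ a S + ∑ (λ σ → sum (r σ)) S
      ≈⟨ +-cong (sym (∑-filter (nonFall? H) f S))
          (trans (∑-sum r S) (sum-cong-≋ {suc n} (λ q → trans (∑-when (toℕ q ℕₚ.<? toℕ H) _ S)
            (when-cong (toℕ q ℕₚ.<? toℕ H) (λ _ → sym (∑-filter (falling? H q) f S)))))) ⟩
    ∑ f (filter (nonFall? H) S) + sum (falling-sum H f) ∎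
    where
    S = Sym (suc n)
    a : Vec (Fin (suc n)) (suc n) → Carrier
    a σ = when (nonFall? H σ) (f σ)
    r : Vec (Fin (suc n)) (suc n) → Fin (suc n) → Carrier
    r σ q = when (toℕ q ℕₚ.<? toℕ H) (when (falling? H q σ) (f σ))
    module _ (σ : Vec (Fin (suc n)) (suc n)) where
      r-no : ∀ q → ¬ (toℕ q < toℕ H × Falling H q σ) → r σ q ≈ 0#
      r-no q ¬r with toℕ q ℕₚ.<? toℕ H
      ... | no _ = refl
      ... | yes lt = when-no (falling? H q σ) (λ r → ¬r (lt , r))
      pointwise : Dec (Escapes (toℕ H) σ) → when (escapes? (toℕ H) σ) (f σ) ≈ a σ + sum (r σ)
      pointwise (no ¬e) = trans (when-no (escapes? (toℕ H) σ) ¬e) (sym (trans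
        (+-cong (when-no (nonFall? H σ) (¬e ∘ proj₁)) (sum-zero (r σ) λ q → r-no q (¬e ∘ proj₁ ∘ proj₂))) (+-identityˡ 0#)))
      pointwise (yes e) with ℕₚ.<-≤-connex (toℕ (lookup σ H)) (toℕ H)
      ... | inj₁ lt = trans (when-yes (escapes? (toℕ H) σ) e) (sym (trans (+-cong (when-no (nonFall? H σ) (λ (_ , ge) → ℕₚ.<⇒≱ lt ge))
              (sum-single (r σ) (lookup σ H) (trans (when-yes (_ ℕₚ.<? toℕ H) lt) (when-yes (falling? H _ σ) (e , ≡.refl)))
                λ j j≢ → r-no j λ (_ , _ , e') → j≢ (≡.sym e'))) (+-identityˡ _)))
      ... | inj₂ ge = trans (when-yes (escapes? (toℕ H) σ) e) (sym (trans (+-cong (when-yes (nonFall? H σ) (e , ge))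
              (sum-zero (r σ) λ q → r-no q λ (lt , _ , e') → ℕₚ.<⇒≱ lt (≡.subst (λ z → toℕ H ≤ toℕ z) e' ge))) (+-identityʳ _)))

  -- The coefficients are left free because the lemma serves twice: for H itself when it does not
  -- fall, and for the index p that replaces a fallen H, whose weight is that of a peak or a double
  -- fall. The coefficient of a rise may depend on τ; only its total over q has to be constant.
  nonFall-sum : ∀ {n} (H : Fin (suc n)) (f : Vec (Fin (suc n)) (suc n) → Carrier)
    (a b : Carrier) (r : Fin n → Vec (Fin n) n → Carrier) (ρ : Carrier)
    → (∀ {σ} → Perm σ → Escapes (suc (toℕ H)) σ → f σ ≈ a * W σ (suc (toℕ H)))
    → (∀ {σ} → Perm σ → Fixing H σ → f σ ≈ b * W σ (suc (toℕ H)))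
    → (∀ {q σ τ} → Perm σ → Del H σ τ → toℕ q < toℕ H → Rising H q σ → f σ ≈ r q τ * W σ (suc (toℕ H)))
    → (∀ {τ} → Perm τ → sum (λ q → when (toℕ q ℕₚ.<? toℕ H) (r q τ)) ≈ ρ)
    → ∑ f (filter (nonFall? H) (Sym (suc n))) ≈ a * T (suc n) (suc (toℕ H)) + b * (lam * T n (toℕ H)) + ρ * T n (toℕ H)
  nonFall-sum {n} H f a b r ρ valleys fixeds rises total = trans (nonFall-split H f) (+-cong (+-cong valley-part fixed-part) rise-part)
    where
    h = toℕ H
    T-list = filter (escapes? {n} h) (Sym n)

    valley-part : ∑ f (filter (escapes? (suc h)) (Sym (suc n))) ≈ a * T (suc n) (suc h)
    valley-part = trans (∑-cong (filter (escapes? (suc h)) (Sym (suc n))) (λ σ∈ →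
        let (σ∈Sym , e) = ∈ₚ.∈-filter⁻ (escapes? (suc h)) {xs = Sym (suc n)} σ∈ in valleys (∈-Sym⁻ σ∈Sym) e))
      (∑-* a (filter (escapes? (suc h)) (Sym (suc n))))

    fixed-part : ∑ f (filter (fixing? H) (Sym (suc n))) ≈ b * (lam * T n h)
    fixed-part = trans
      (∑-Del {d = H} nothing (fixing? H) (escapes? h) proj₂
        (λ _ _ D (e , fx) → escapes-delete D (ℕₚ.≤-reflexive (≡.cong toℕ (≡.sym fx))) e)
        (λ _ _ D fx e → escapes-insert D e , fx)
        (λ p q D (e , fx) → trans (fixeds p (e , fx)) (*-congˡ (W-Del-fixed p q D h ℕₚ.≤-refl
          (λ s σs≡H → ℕₚ.≤-reflexive (≡.cong toℕ (p _ _ (≡.trans σs≡H (≡.sym fx))))) fx))))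
      (trans (∑-* b T-list) (*-congˡ (∑-* lam T-list)))

    one-rise : ∀ q → toℕ q < h → ∑ f (filter (rising? H q) (Sym (suc n))) ≈ ∑ (λ τ → r q τ * W τ h) T-list
    one-rise q q<h = ∑-Del {d = H} (just q) (rising? H q) (escapes? h) (proj₁ ∘ proj₂)
      (λ _ _ D (e , _ , gt) → escapes-delete D (ℕₚ.<⇒≤ gt) e)
      (λ _ _ D b e → escapes-insert D e , b , exceeds-insert D q q<h b e)
      (λ p p' D R@(_ , e , gt) → trans (rises p D q<h R) (*-congˡ (W-Del-moved p p' D h ℕₚ.≤-refl
        (λ s σs≡H → ≡.subst (λ z → toℕ z ≤ h) (p _ _ (≡.trans e (≡.sym σs≡H)))
          (ℕₚ.≤-trans (ℕₚ.≤-reflexive (toℕ-punchIn-< q<h)) (ℕₚ.<⇒≤ q<h)))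
        (λ e' → ℕₚ.<⇒≢ gt (≡.cong toℕ (≡.sym e'))))))

    rise-part : sum (rising-sum H f) ≈ ρ * T n h
    rise-part = begin
      sum (rising-sum H f)
        ≈⟨ sum-cong-≋ {n} (λ q → when-cong (toℕ q ℕₚ.<? h) (one-rise q)) ⟩
      sum (λ q → when (toℕ q ℕₚ.<? h) (∑ (λ τ → r q τ * W τ h) T-list))
        -- The sums are exchanged so that `total` can be applied for each fixed τ.
        ≈⟨ sum-cong-≋ {n} (λ q → sym (∑-when (toℕ q ℕₚ.<? h) _ T-list)) ⟩
      sum (λ q → ∑ (λ τ → when (toℕ q ℕₚ.<? h) (r q τ * W τ h)) T-list)
        ≈⟨ sym (∑-sum (λ τ q → when (toℕ q ℕₚ.<? h) (r q τ * W τ h)) T-list) ⟩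
      ∑ (λ τ → sum (λ q → when (toℕ q ℕₚ.<? h) (r q τ * W τ h))) T-list
        ≈⟨ ∑-cong T-list (λ {τ} τ∈ → trans
             (trans (sum-cong-≋ {n} (λ q → sym (when-* (toℕ q ℕₚ.<? h)))) (sym (sum-*ʳ (λ q → when (toℕ q ℕₚ.<? h) (r q τ)) (W τ h))))
             (*-congʳ (total (∈-Sym⁻ (proj₁ (∈ₚ.∈-filter⁻ (escapes? h) {xs = Sym n} τ∈)))))) ⟩
      ∑ (λ τ → ρ * W τ h) T-list
        ≈⟨ ∑-* ρ T-list ⟩
      ρ * T n h ∎

  -- All h indices below H escape, and none takes the value H, which H itself occupies; so all of
  -- them are counted.
  psnest-fixing : ∀ {n} (H : Fin (suc n)) {σ} → Perm σ → Fixing H σ → psnest σ H ≡ toℕ H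
  psnest-fixing {n} H {σ} σ-perm (e , fx) = ≡.trans
    (matching-length (λ a (b : Fin (toℕ H)) → toℕ a ≡ toℕ b)
      (λ p q → Fₚ.toℕ-injective (≡.trans (≡.sym p) q)) (λ p q → Fₚ.toℕ-injective (≡.trans p (≡.sym q)))
      (Uₚ.filter⁺ nests? (Uₚ.allFin⁺ _)) (Uₚ.allFin⁺ _) total onto)
    (Lₚ.length-tabulate {n = toℕ H} id)
    where
    nests? = λ j → _×-dec_ (_<F?_ σ j H) (_<F?_ σ H (lookup σ j))
    total : ∀ {a} → a ∈ filter nests? (allFin _) → ∃ λ b → b ∈ allFin (toℕ H) × toℕ a ≡ toℕ b
    total a∈ with ∈ₚ.∈-filter⁻ nests? {xs = allFin _} a∈
    ... | _ , a<H , _ = F.fromℕ< a<H , ∈ₚ.∈-allFin _ , ≡.sym (Fₚ.toℕ-fromℕ< a<H)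
    onto : ∀ {b} → b ∈ allFin (toℕ H) → ∃ λ a → a ∈ filter nests? (allFin _) × toℕ a ≡ toℕ b
    onto {b} _ = a , ∈ₚ.∈-filter⁺ nests? (∈ₚ.∈-allFin a) (a<H , ℕₚ.≤∧≢⇒< (e a a<H) λ e' →
        ℕₚ.<⇒≢ a<H (≡.cong toℕ (σ-perm _ _ (≡.trans (Fₚ.toℕ-injective (≡.sym e')) (≡.sym fx))))) , eq
      where
      b<n : toℕ b < suc n
      b<n = ℕₚ.<-trans (Fₚ.toℕ<n b) (Fₚ.toℕ<n H)
      a = F.fromℕ< b<n
      eq : toℕ a ≡ toℕ b
      eq = Fₚ.toℕ-fromℕ< b<n
      a<H : a F.< H
      a<H = ≡.subst (_< toℕ H) (≡.sym eq) (Fₚ.toℕ<n b)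

  -- Zero at height 0, where no earlier index can precede H; hence γ₀ contains no y₂.
  riseTotal : ℕ → Carrier
  riseTotal zero    = 0#
  riseTotal (suc k) = y₂ + k · v₂

  nonFall-T : ∀ {n} (H : Fin (suc n))
    → ∑ (λ σ → W σ (toℕ H)) (filter (nonFall? H) (Sym (suc n)))
      ≈ y₁ * T (suc n) (suc (toℕ H)) + w (toℕ H) * (lam * T n (toℕ H)) + riseTotal (toℕ H) * T n (toℕ H)
  nonFall-T {n} H = nonFall-sum H (λ σ → W σ (toℕ H)) y₁ (w (toℕ H))
    (λ q τ → value (riseᴸ (Dec.does (maxBelow? (toℕ H) τ q)))) (riseTotal (toℕ H))
    (λ {σ} p e → labelled {σ} p (valley′ {σ} p e))
    (λ {σ} p fx → labelled {σ} p (≡.subst (HasLabel σ H ∘ fixᴸ) (psnest-fixing H {σ} p fx) (fix (proj₂ fx))))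
    (λ {q} {σ} {τ} p D q<H (e , σq≡H , gt) → labelled {σ} p (rise σq≡H (≡.subst (_< toℕ H) (≡.sym (toℕ-punchIn-< q<H)) q<H) gt
      (Reflects-map (proj₁ (rising-record⇔ p D q<H σq≡H gt)) (proj₂ (rising-record⇔ p D q<H σq≡H gt)) (reflected (maxBelow? (toℕ H) τ q)))))
    (λ {τ} q → rises {τ} q (toℕ H) (ℕ.s≤s⁻¹ (Fₚ.toℕ<n H)))
    where
    labelled : ∀ {σ l} → Perm σ → HasLabel σ H l → W σ (toℕ H) ≈ value l * W σ (suc (toℕ H))
    labelled {σ} p has = trans (W-step σ H) (*-congʳ (loc-value {σ = σ} p H has))
    valley′ : ∀ {σ} → Perm σ → Escapes (suc (toℕ H)) σ → HasLabel σ H valleyᴸ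
    valley′ {σ} p e with Inj⇒surjective p H
    ... | s , σs≡H = valley σs≡H (ℕₚ.≰⇒> λ s≤H → ℕₚ.<⇒≢ (e s (s≤s s≤H)) (≡.sym (≡.cong toℕ σs≡H)))
                            (e H ℕₚ.≤-refl)
    rises : ∀ {τ : Vec (Fin n) n} → Perm τ → ∀ h → h ≤ n
      → sum (λ q → when (toℕ q ℕₚ.<? h) (value (riseᴸ (Dec.does (maxBelow? h τ q))))) ≈ riseTotal h
    rises {τ} p zero    _  = sum-zero {n} _ (λ q → when-no (toℕ q ℕₚ.<? 0) {value (riseᴸ (Dec.does (maxBelow? 0 τ q)))} ℕₚ.n≮0)
    rises {τ} p (suc k) le with maxBelow-exists τ p k le
    ... | q , q≤k , max = sum-below-marked (maxBelow? (suc k) τ) q q≤k le max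
            (λ j j≤k m → maxBelow-unique {τ = τ} j≤k q≤k m max) y₂ v₂

  T-zero : ∀ n → T (suc n) 0 ≈ lam * w 0 * T n 0 + y₁ * T (suc n) 1
  T-zero n = begin
    T (suc n) 0
      ≈⟨ escapes-split {n} zero (λ σ → W σ 0) ⟩
    _ + sum {suc n} (falling-sum zero (λ σ → W σ 0))
      ≈⟨ +-cong (nonFall-T {n} zero) (sum-zero {suc n} (falling-sum zero (λ σ → W σ 0)) (λ r → when-no (toℕ r ℕₚ.<? 0) {∑ (λ σ → W σ 0) (filter (falling? zero r) (Sym (suc n)))} ℕₚ.n≮0)) ⟩
    y₁ * T (suc n) 1 + w 0 * (lam * T n 0) + 0# * T n 0 + 0#
      ≈⟨ solve 5 (λ y t w l u → y :* t :+ w :* (l :* u) :+ con 0 :* u :+ con 0 := l :* w :* u :+ y :* t) refl y₁ (T (suc n) 1) (w 0) lam (T n 0) ⟩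
    lam * w 0 * T n 0 + y₁ * T (suc n) 1 ∎
    where open Solver commutativeSemiring

  -- Deleting r = σ(H) turns H = suc p into an element of the smaller state that no
  -- longer falls: a valley if H was a double fall, a rise if H was a peak joining two
  -- paths, and a fixed point if H was a peak closing a cycle.
  falling-T : ∀ {n} (p : Fin (suc n)) (r : Fin (suc (suc n))) → toℕ r ≤ toℕ p
    → ∑ (λ σ → W σ (suc (toℕ p))) (filter (falling? (suc p) r) (Sym (suc (suc n))))
      ≈ value (fallᴸ (Dec.does (toℕ r ℕₚ.≟ 0))) * T (suc n) (suc (toℕ p))
        + value (peakᴸ (Dec.does (toℕ r ℕₚ.≟ 0))) * (lam * T n (toℕ p))
        + (toℕ p · value (peakᴸ (Dec.does (toℕ r ℕₚ.≟ 0)))) * T n (toℕ p)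
  falling-T {n} p r r≤p = trans
    (∑-Del {d = r} (just p) (falling? H r) (nonFall? p) (λ {σ} (_ , e) → ≡.trans (≡.cong (lookup σ) (H≡ψ r≤p)) e)
      (λ q _ D (e , σH≡r) → falling-delete r≤p q D σH≡r e)
      (λ {σ} q _ D b nf → let σH≡r = ≡.trans (≡.cong (lookup σ) (≡.sym (H≡ψ r≤p))) b in falling-insert r≤p q D σH≡r nf , σH≡r)
      (λ {σ} {τ} q q' D (e , σH≡r) → weights q q' D e σH≡r))
    -- The weight given to p is the one H had in σ. It is the same for all p possible predecessors
    -- of a rise, so they contribute a plain multiple.
    (nonFall-sum p g F′ P′ (λ _ _ → P′) (toℕ p · P′)
      (λ {τ} q e → *-congʳ (κ-no τ λ (s , s≤p , τs≡p) → ℕₚ.<⇒≢ (e s (s≤s s≤p)) (≡.sym (≡.cong toℕ τs≡p))))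
      (λ {τ} _ (_ , fx) → *-congʳ (κ-yes τ (p , ℕₚ.≤-refl , fx)))
      (λ {s} {τ} _ _ s<p (_ , e , _) → *-congʳ (κ-yes τ (punchIn p s , ℕₚ.≤-trans (ℕₚ.≤-reflexive (toℕ-punchIn-< s<p)) (ℕₚ.<⇒≤ s<p) , e)))
      (λ _ → sum-below (toℕ p) (ℕ.s≤s⁻¹ (Fₚ.toℕ<n p)) P′))
    where
    H : Fin (suc (suc n))
    H = suc p
    H≡ψ : toℕ r ≤ toℕ p → punchIn r p ≡ suc p
    H≡ψ le = Fₚ.toℕ-injective (toℕ-punchIn-≥ le)
    least = Dec.does (toℕ r ℕₚ.≟ 0)
    F′ = value (fallᴸ least)
    P′ = value (peakᴸ least)

    -- This reads off from τ whether H was a peak: its predecessor then appears as a preimage of p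
    -- below p, or as p itself if H closed a cycle.
    EarlyPreimage : Vec (Fin (suc n)) (suc n) → Set
    EarlyPreimage τ = ∃ λ s → s F.≤ p × lookup τ s ≡ p
    early? : Decidable EarlyPreimage
    early? τ = Fₚ.any? λ s → (s F.≤? p) ×-dec (lookup τ s F.≟ p)
    κ g : Vec (Fin (suc n)) (suc n) → Carrier
    κ τ = if Dec.does (early? τ) then P′ else F′
    g τ = κ τ * W τ (suc (toℕ p))
    κ-yes : ∀ τ → EarlyPreimage τ → κ τ ≈ P′
    κ-yes τ = if-yes (early? τ)
    κ-no : ∀ τ → ¬ EarlyPreimage τ → κ τ ≈ F′
    κ-no τ = if-no (early? τ)

    module _ {σ τ} (σ-perm : Perm σ) (τ-perm : Perm τ) (D : Del r σ τ) (e : Escapes (suc (toℕ p)) σ) (σH≡r : lookup σ H ≡ r) where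
      falls : lookup σ H F.< H
      falls = ≡.subst (F._< H) (≡.sym σH≡r) (s≤s r≤p)
      least-reflects : Reflects (AntiRecord σ H) least
      least-reflects = Reflects-map (proj₂ iff) (proj₁ iff) (reflected (toℕ r ℕₚ.≟ 0))
        where iff = falling-antirecord⇔ {σ = σ} σ-perm e σH≡r (s≤s r≤p)

      label : loc σ H ≈ κ τ
      label with Inj⇒surjective τ-perm p
      ... | s , τs≡p with ℕₚ.<-cmp (toℕ s) (toℕ p)
      ...   | tri< s<p s≢p _ = trans (loc-value {σ = σ} σ-perm H (peak (preimage-of-H r≤p σ-perm D σH≡r τs≡p (λ { ≡.refl → s≢p ≡.refl }))
                (≡.subst (punchIn r s F.<_) (H≡ψ r≤p) (punchIn-mono-< r s<p)) falls least-reflects))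
                (sym (κ-yes τ (s , ℕₚ.<⇒≤ s<p , τs≡p)))
      ...   | tri> _ s≢p p<s = trans (loc-value {σ = σ} σ-perm H (fall (preimage-of-H r≤p σ-perm D σH≡r τs≡p (λ { ≡.refl → s≢p ≡.refl }))
                (≡.subst (F._< punchIn r s) (H≡ψ r≤p) (punchIn-mono-< r p<s)) falls least-reflects))
                (sym (κ-no τ λ (s' , s'≤p , e') → ℕₚ.<⇒≱ p<s (≡.subst (F._≤ p) (τ-perm _ _ (≡.trans e' (≡.sym τs≡p))) s'≤p)))
      ...   | tri≈ _ s≡p _ with Fₚ.toℕ-injective s≡p
      ...     | ≡.refl = trans (loc-value {σ = σ} σ-perm H (peak (bypassed-to-H r≤p σ-perm D σH≡r τs≡p) (s≤s r≤p) falls least-reflects))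
                (sym (κ-yes τ (p , ℕₚ.≤-refl , τs≡p)))

      weights : W σ (suc (toℕ p)) ≈ g τ
      -- The deletion is cut off at p + 1, the position of H, because H is the preimage of the
      -- deleted r.
      weights = trans (W-step σ H) (*-cong label (W-Del-moved σ-perm τ-perm D (suc (toℕ p)) (ℕₚ.m≤n⇒m≤1+n r≤p)
        (λ s σs≡r → ℕₚ.≤-reflexive (≡.cong toℕ (σ-perm _ _ (≡.trans σs≡r (≡.sym σH≡r)))))
        (λ e' → ℕₚ.<⇒≢ (s≤s r≤p) (≡.cong toℕ (σ-perm _ _ (≡.trans e' (≡.sym σH≡r)))))))

  ·-as-* : ∀ k a → k · a ≈ (k · 1#) * a
  ·-as-* zero    a = sym (zeroˡ a)
  ·-as-* (suc k) a = trans (+-cong (sym (*-identityˡ a)) (·-as-* k a)) (sym (distribʳ a 1# (k · 1#)))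

  least-total : ∀ {n} (p : Fin (suc n)) a b
    → sum {suc (suc n)} (λ r → when (toℕ r ℕₚ.<? suc (toℕ p)) (if Dec.does (toℕ r ℕₚ.≟ 0) then a else b)) ≈ a + toℕ p · b
  least-total p = sum-below-marked (λ r → toℕ r ℕₚ.≟ 0) zero z<s (ℕₚ.m≤n⇒m≤1+n (Fₚ.toℕ<n p)) ≡.refl (λ j _ → Fₚ.toℕ-injective)

  T-suc : ∀ {n} (p : Fin (suc n)) → let k = toℕ p in
    T (suc (suc n)) (suc k) ≈ γseq x₂ y₂ u₂ v₂ w lam (suc k) * T (suc n) (suc k) + y₁ * T (suc (suc n)) (suc (suc k))
                              + (lam + k · 1#) * (x₁ + k · u₁) * T n k
  T-suc {n} p = begin
    T (suc (suc n)) (suc k)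
      ≈⟨ escapes-split H (λ σ → W σ (suc k)) ⟩
    ∑ (λ σ → W σ (suc k)) (filter (nonFall? H) (Sym (suc (suc n)))) + sum (falling-sum H (λ σ → W σ (suc k)))
      ≈⟨ +-cong (nonFall-T H) falls ⟩
    y₁ * B + w (suc k) * (lam * A) + (y₂ + k · v₂) * A + ((x₂ + k · u₂) * A + (x₁ + k · u₁) * ((lam + k · 1#) * Z))
      ≈⟨ solve 10 (λ y B w l A c x d e Z → y :* B :+ w :* (l :* A) :+ c :* A :+ (x :* A :+ d :* (e :* Z))
             := (x :+ c :+ l :* w) :* A :+ y :* B :+ e :* d :* Z) refl
           y₁ B (w (suc k)) lam A (y₂ + k · v₂) (x₂ + k · u₂) (x₁ + k · u₁) (lam + k · 1#) Z ⟩
    γseq x₂ y₂ u₂ v₂ w lam (suc k) * A + y₁ * B + (lam + k · 1#) * (x₁ + k · u₁) * Z ∎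
    where
    open Solver commutativeSemiring
    H : Fin (suc (suc n))
    H = suc p
    k = toℕ p
    A = T (suc n) (suc k)
    B = T (suc (suc n)) (suc (suc k))
    Z = T n k
    F′ P′ : Fin (suc (suc n)) → Carrier
    F′ r = value (fallᴸ (Dec.does (toℕ r ℕₚ.≟ 0)))
    P′ r = value (peakᴸ (Dec.does (toℕ r ℕₚ.≟ 0)))
    below? : (r : Fin (suc (suc n))) → Dec (toℕ r < suc k)
    below? r = toℕ r ℕₚ.<? suc k
    when-linear : ∀ {C : Set} (C? : Dec C) a b → when C? (a * A + b * ((lam + k · 1#) * Z))
      ≈ when C? a * A + when C? b * ((lam + k · 1#) * Z)
    when-linear (yes _) a b = refl
    when-linear (no _)  a b = sym (trans (+-cong (zeroˡ _) (zeroˡ _)) (+-identityʳ 0#))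
    term : ∀ r → falling-sum H (λ σ → W σ (suc k)) r
      ≈ when (below? r) (F′ r) * A + when (below? r) (P′ r) * ((lam + k · 1#) * Z)
    -- For each r the peak weight multiplies lam (the cycle closes) and k (one of the k other paths
    -- is joined). The factor lam + k is thus free of r and can be taken out before summing over r.
    term r = trans (when-cong (below? r) (λ r<H → trans (falling-T p r (ℕ.s≤s⁻¹ r<H))
        (trans (+-congˡ (*-congʳ (·-as-* k (P′ r))))
          (solve 6 (λ f A p l Z e → f :* A :+ p :* (l :* Z) :+ e :* p :* Z := f :* A :+ p :* ((l :+ e) :* Z)) refl
            (F′ r) A (P′ r) lam Z (k · 1#)))))
      (when-linear (below? r) (F′ r) (P′ r))
    falls : sum (falling-sum H (λ σ → W σ (suc k))) ≈ (x₂ + k · u₂) * A + (x₁ + k · u₁) * ((lam + k · 1#) * Z)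
    falls = begin
      sum (falling-sum H (λ σ → W σ (suc k)))
        ≈⟨ sum-cong-≋ {suc (suc n)} term ⟩
      sum (λ r → when (below? r) (F′ r) * A + when (below? r) (P′ r) * ((lam + k · 1#) * Z))
        ≈⟨ ∑-distrib-+ (λ r → when (below? r) (F′ r) * A) (λ r → when (below? r) (P′ r) * ((lam + k · 1#) * Z)) ⟩
      sum (λ r → when (below? r) (F′ r) * A) + sum (λ r → when (below? r) (P′ r) * ((lam + k · 1#) * Z))
        ≈⟨ +-cong (trans (sym (sum-*ʳ (λ r → when (below? r) (F′ r)) A)) (*-congʳ (least-total p x₂ u₂)))
                  (trans (sym (sum-*ʳ (λ r → when (below? r) (P′ r)) _)) (*-congʳ (least-total p x₁ u₁))) ⟩
      (x₂ + k · u₂) * A + (x₁ + k · u₁) * ((lam + k · 1#) * Z) ∎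

  conv≈Qhat : ∀ n k → n ≤ k
    → conv (γseq x₂ y₂ u₂ v₂ w lam) (βseq x₁ y₁ u₁ lam) k 0 n ≈ Qhat n x₁ x₂ y₁ y₂ u₁ u₂ y₁ v₂ w lam
  conv≈Qhat n k n≤k = trans
    (conv≈G γ (βseq x₁ y₁ u₁ lam) b y₁ (λ _ → refl) G T-00 G-0s T-zero G-ss k n n≤k)
    (sym (Qhat≈T n))
    where
    open Fraction R using (conv≈G)
    γ = γseq x₂ y₂ u₂ v₂ w lam
    b : ℕ → Carrier
    b m = (lam + m · 1#) * (x₁ + m · u₁)
    -- N = n - h counts the indices not yet scanned. A valley raises h by one; a fixed point, rise
    -- or double fall lowers n by one; a peak lowers n by two and h by one: each uses exactly one
    -- step.
    G : ℕ → ℕ → Carrier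
    G N h = T (h ℕ.+ N) h
    G-0s : ∀ h → G 0 (suc h) ≈ 0#
    G-0s h = trans (reflexive (≡.cong (λ n → T (suc n) (suc h)) (ℕₚ.+-identityʳ h))) (T-diagonal h)
    G-ss : ∀ N h → G (suc N) (suc h) ≈ γ (suc h) * G N (suc h) + y₁ * G N (suc (suc h)) + b h * G N h
    G-ss N h = trans (reflexive (≡.cong (λ n → T (suc n) (suc h)) (ℕₚ.+-suc h N)))
      (≡.subst (λ k → T (suc (suc m)) (suc k) ≈ γ (suc k) * T (suc m) (suc k) + y₁ * T (suc (suc m)) (suc (suc k)) + b k * T m k)
        (Fₚ.toℕ-fromℕ< h≤m) (T-suc (F.fromℕ< h≤m)))
      where
      m = h ℕ.+ N
      h≤m : h < suc m
      h≤m = s≤s (ℕₚ.m≤m+n h N)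

theorem3p1 : ∀ {c ℓ : Level} (R : CommutativeRing c ℓ)
    → let open Ring R in
    ∀ (x₁ x₂ y₁ y₂ u₁ u₂ v₂ : Carrier) (w : ℕ → Carrier) (lam : Carrier)
    → ∀ (n : ℕ) → ∃ λ (K : ℕ) → ∀ (k : ℕ) → K ≤ k
    → conv (γseq x₂ y₂ u₂ v₂ w lam) (βseq x₁ y₁ u₁ lam) k 0 n
    ≈ Qhat n x₁ x₂ y₁ y₂ u₁ u₂ y₁ v₂ w lam
theorem3p1 R x₁ x₂ y₁ y₂ u₁ u₂ v₂ w lam n =
  n , λ k → Recurrence.conv≈Qhat R x₁ x₂ y₁ y₂ u₁ u₂ v₂ w lam n k
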